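{- For every $\mu\in\mathbb F_q\setminus\{0\}$, the elliptic quadric $\mathcal Q_\mu$ is a $\left(\frac{q^n-1}{q-1}\right)$-ovoid of $\mathcal W_0$, i.e. every generator of $\mathcal W_0$ contains exactly $\frac{q^n-1}{q-1}$ points of $\mathcal Q_\mu$. (Note that for $\mu\neq0$ the quadric $\mathcal Q_\mu$ does not polarize to $\mathcal W_0$.)
   Context: Let $q$ be an even prime power and $n\ge 2$ an integer. Let $\mathrm{PG}(2n+1,q)$ have homogeneous coordinates $(X_1,\dots,X_{2n+2})$. Fix $\delta\in\mathbb F_q$ such that $X^2+X+\delta$ is irreducible over $\mathbb F_q$. For $\mu\in\mathbb F_q$ let $\mathcal Q_\mu$ be the quadric $X_1^2+X_1X_{2n+2}+\delta X_{2n+2}^2+\sum_{i=2}^{n+1}X_iX_{2n+3-i}+\mu(X_{2n}^2+X_{2n}X_{2n+1}+\delta X_{2n+1}^2)=0$, an elliptic quadric. Let $\mathcal W_0$ be the symplectic polar space defined by the alternating form $B_0(X,Y)=\sum_{i=1}^{2n+2}X_iY_{2n+3-i}$ (the polar space to which $\mathcal Q_0$ polarizes); its generators are the totally isotropic $n$-spaces. An $m$-ovoid of a symplectic polar space is a set of points meeting every generator in exactly $m$ points. -}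

module Defs where

open import Algebra.Bundles using (CommutativeRing)
open import Algebra.Bundles.Raw using (RawSemiring)
import Algebra.Definitions
import Algebra.Definitions.RawSemiring
import Algebra.Properties.CommutativeSemigroup
import Algebra.Properties.Semiring.Sum
open import Data.Fin.Base as Fin using (Fin; inject₁; opposite; _↑ˡ_)
open import Data.List.Base as List using (List; []; _∷_)
open import Data.Nat.Base using (ℕ; zero; suc; _∸_; _^_; _≤_; _<_; NonZero; >-nonZero; nonTrivial⇒n>1)
open import Data.Nat.Divisibility.Core using (_∣_)
open import Data.Nat.Primality using (Prime; prime⇒nonTrivial)
open import Data.Nat.Properties using (m<n⇒0<n∸m; <-≤-trans; ≤-trans; ≤-reflexive; ^-monoʳ-≤; ^-identityʳ; <-trans; n<1+n)
import Data.Nat.Base as ℕ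
open import Data.Product.Base using (Σ-syntax; ∃-syntax; ∃₂; _×_; _,_; proj₁; proj₂)
open import Data.Vec.Functional using (Vector)
import Data.Vec.Functional.Relation.Binary.Equality.Setoid
open import Function.Bundles using (Inverse)
open import Level using (Level; _⊔_) renaming (suc to lsuc)
open import Relation.Binary.Bundles using (Setoid)
import Relation.Binary.Construct.On as On
open import Relation.Binary.Definitions using (_Respects_)
open import Relation.Binary.PropositionalEquality as ≡ using (_≡_)
import Relation.Binary.Reasoning.Setoid
open import Relation.Nullary.Negation using (¬_)
open import Relation.Unary using (Pred)

IsPrimePower : ℕ → Set
IsPrimePower q = ∃₂ λ p k → Prime p × 1 ≤ k × q ≡ p ^ k

IsEvenPrimePower : ℕ → Set
IsEvenPrimePower q = IsPrimePower q × 2 ∣ q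

primePower>1 : ∀ {q} → IsPrimePower q → 1 < q
primePower>1 (p , k , p-prime , 1≤k , ≡.refl) =
  <-≤-trans 1<p (≤-trans (≤-reflexive (≡.sym (^-identityʳ p))) (^-monoʳ-≤ p 1≤k))
  where
  1<p : 1 < p
  1<p = nonTrivial⇒n>1 p {{prime⇒nonTrivial p-prime}}
  instance
    p≢0 : NonZero p
    p≢0 = >-nonZero (<-trans (n<1+n 0) 1<p)

q∸1≢0 : ∀ {q} → IsEvenPrimePower q → NonZero (q ∸ 1)
q∸1≢0 (pp , _) = >-nonZero (m<n⇒0<n∸m (primePower>1 pp))

HasCardinality : ∀ {a ℓ} → Setoid a ℓ → ℕ → Set (a ⊔ ℓ)
HasCardinality S m = Inverse S (≡.setoid (Fin m))

record FiniteField (c ℓ : Level) (q : ℕ) : Set (lsuc (c ⊔ ℓ)) where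
  field
    commutativeRing : CommutativeRing c ℓ
  open CommutativeRing commutativeRing public
  open Algebra.Definitions _≈_ using (Invertible)
  field
    1≉0        : 1# ≉ 0#
    invertible : ∀ x → x ≉ 0# → Invertible 1# _*_ x
    order      : HasCardinality setoid q

-- The number 2n + 2 of homogeneous coordinates of PG(2n+1, q).
dim : ℕ → ℕ
dim n = 2 ℕ.+ 2 ℕ.* n

module _ {c ℓ q} (F : FiniteField c ℓ q) where

  open FiniteField F renaming (Carrier to K)
  open Algebra.Definitions.RawSemiring using (Irreducible)
  open Algebra.Properties.Semiring.Sum semiring using (sum; sum-cong-≋; *-distribˡ-sum)
  open Algebra.Properties.CommutativeSemigroup *-commutativeSemigroup using (interchange; x∙yz≈y∙xz)
  open Data.Vec.Functional.Relation.Binary.Equality.Setoid setoid using (_≋_)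
  open Relation.Binary.Reasoning.Setoid setoid

  -- Univariate polynomials as coefficient lists, lowest degree first; trailing
  -- zeros are allowed, so equality compares all coefficients.

  coeff : List K → ℕ → K
  coeff []       _       = 0#
  coeff (a ∷ _)  zero    = a
  coeff (_ ∷ as) (suc i) = coeff as i

  _+ᴾ_ : List K → List K → List K
  []       +ᴾ bs       = bs
  (a ∷ as) +ᴾ []       = a ∷ as
  (a ∷ as) +ᴾ (b ∷ bs) = (a + b) ∷ (as +ᴾ bs)

  _*ᴾ_ : List K → List K → List K
  []       *ᴾ bs = []
  (a ∷ as) *ᴾ bs = List.map (a *_) bs +ᴾ (0# ∷ (as *ᴾ bs))

  K[X] : RawSemiring c ℓ
  K[X] = record
    { Carrier = List K
    ; _≈_     = λ as bs → ∀ i → coeff as i ≈ coeff bs i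
    ; _+_     = _+ᴾ_
    ; _*_     = _*ᴾ_
    ; 0#      = []
    ; 1#      = 1# ∷ []
    }

  -- X² + X + δ is irreducible in K[X]
  IsIrreducibleX²+X+ : K → Set (c ⊔ ℓ)
  IsIrreducibleX²+X+ δ = Irreducible K[X] (δ ∷ 1# ∷ 1# ∷ [])

  -- PG(N - 1, q): points are non-zero vectors of Kᴺ up to a non-zero scalar.

  Point : ℕ → Set (c ⊔ ℓ)
  Point N = Σ[ v ∈ Vector K N ] ¬ (v ≋ λ _ → 0#)

  infix 4 _∼_
  _∼_ : ∀ {N} → Point N → Point N → Set (c ⊔ ℓ)
  (u , _) ∼ (v , _) = ∃[ a ] a ≉ 0# × u ≋ (λ i → a * v i)

  private
    cancel : ∀ {a b} x → b * a ≈ 1# → b * (a * x) ≈ x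
    cancel {a} {b} x ba≈1 = begin
      b * (a * x) ≈⟨ *-assoc b a x ⟨
      b * a * x   ≈⟨ *-congʳ ba≈1 ⟩
      1# * x      ≈⟨ *-identityˡ x ⟩
      x           ∎

    ab≉0 : ∀ {a b} → a ≉ 0# → b ≉ 0# → a * b ≉ 0#
    ab≉0 {a} {b} a≉0 b≉0 ab≈0 with invertible a a≉0
    ... | a⁻¹ , a⁻¹a≈1 , _ =
      b≉0 (trans (sym (cancel b a⁻¹a≈1)) (trans (*-congˡ ab≈0) (zeroʳ a⁻¹)))

    ∼-sym : ∀ {N} {P Q : Point N} → P ∼ Q → Q ∼ P
    ∼-sym {P = u , _} {v , _} (a , a≉0 , u≋av) with invertible a a≉0
    ... | a⁻¹ , a⁻¹a≈1 , _ =
      a⁻¹ , (λ a⁻¹≈0 → 1≉0 (trans (sym a⁻¹a≈1) (trans (*-congʳ a⁻¹≈0) (zeroˡ a)))) ,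
      λ i → sym (trans (*-congˡ (u≋av i)) (cancel (v i) a⁻¹a≈1))

    ∼-trans : ∀ {N} {P Q R : Point N} → P ∼ Q → Q ∼ R → P ∼ R
    ∼-trans (a , a≉0 , u≋av) (b , b≉0 , v≋bw) =
      a * b , ab≉0 a≉0 b≉0 ,
      λ i → trans (u≋av i) (trans (*-congˡ (v≋bw i)) (sym (*-assoc a b _)))

  PG : ℕ → Setoid (c ⊔ ℓ) (c ⊔ ℓ)
  PG N = record
    { Carrier       = Point N
    ; _≈_           = _∼_
    ; isEquivalence = record
      { refl  = λ {P} → 1# , 1≉0 , λ i → sym (*-identityˡ (proj₁ P i))
      ; sym   = λ {P} {Q} → ∼-sym {P = P} {Q}
      ; trans = λ {P} {Q} {R} → ∼-trans {P = P} {Q} {R}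
      }
    }

  record PointSet (N : ℕ) (p : Level) : Set (c ⊔ ℓ ⊔ lsuc p) where
    field
      has      : Pred (Point N) p
      respects : has Respects _∼_

  record Subspace (N : ℕ) (p : Level) : Set (c ⊔ ℓ ⊔ lsuc p) where
    field
      has      : Pred (Vector K N) p
      respects : has Respects _≋_
      0-closed : has (λ _ → 0#)
      +-closed : ∀ {u v} → has u → has v → has (λ i → u i + v i)
      *-closed : ∀ a {v} → has v → has (λ i → a * v i)

  combination : ∀ {N d} → Vector K d → Vector (Vector K N) d → Vector K N
  combination a b i = sum (λ j → a j * b j i)

  record HasDimension {N p} (U : Subspace N p) (d : ℕ) : Set (c ⊔ ℓ ⊔ p) where
    field
      basis       : Vector (Vector K N) d
      inside      : ∀ j → Subspace.has U (basis j)
      independent : ∀ a → combination a basis ≋ (λ _ → 0#) → a ≋ (λ _ → 0#)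
      spanning    : ∀ {v} → Subspace.has U v → ∃[ a ] v ≋ combination a basis

  -- The points of PG(N - 1, q) lying both in the set S and in the subspace U.
  _∩ᴾ_ : ∀ {N p r} → PointSet N r → Subspace N p → Setoid (c ⊔ ℓ ⊔ p ⊔ r) (c ⊔ ℓ)
  _∩ᴾ_ {N} S U = On.setoid (PG N) point
    where
    point : (Σ[ P ∈ Point N ] PointSet.has S P × Subspace.has U (proj₁ P)) → Point N
    point = proj₁

  ellipticForm : K → K → K → K
  ellipticForm δ x y = x * x + x * y + δ * (y * y)

  ellipticForm-cong : ∀ δ {x x′ y y′} → x ≈ x′ → y ≈ y′ → ellipticForm δ x y ≈ ellipticForm δ x′ y′
  ellipticForm-cong δ e f = +-cong (+-cong (*-cong e e) (*-cong e f)) (*-congˡ (*-cong f f))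

  ellipticForm-scale : ∀ δ a x y → ellipticForm δ (a * x) (a * y) ≈ (a * a) * ellipticForm δ x y
  ellipticForm-scale δ a x y = begin
    ellipticForm δ (a * x) (a * y)
      ≈⟨ +-cong (+-cong (interchange a x a x) (interchange a x a y)) (*-congˡ (interchange a y a y)) ⟩
    (a * a) * (x * x) + (a * a) * (x * y) + δ * ((a * a) * (y * y))
      ≈⟨ +-cong (sym (distribˡ (a * a) _ _)) (x∙yz≈y∙xz δ (a * a) (y * y)) ⟩
    (a * a) * (x * x + x * y) + (a * a) * (δ * (y * y))
      ≈⟨ distribˡ (a * a) _ _ ⟨
    (a * a) * ellipticForm δ x y ∎

  module _ (n : ℕ) where

    -- Fin is 0-based: the coordinate X_i is indexed by the element i - 1, and
    -- opposite takes the index of X_i to that of X_(2n+3-i).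

    -- For j = 0, …, n - 1, the index of X_(j+2).
    lower : Fin n → Fin (dim n)
    lower j = Fin.suc (inject₁ (j ↑ˡ (n ℕ.+ 0)))

    i₁ i₂ₙ₊₂ i₂ₙ₊₁ i₂ₙ : Fin (dim n)
    i₁    = Fin.zero
    i₂ₙ₊₂ = opposite i₁
    i₂ₙ₊₁ = opposite (Fin.suc Fin.zero)
    i₂ₙ   = Fin.pred i₂ₙ₊₁

    B₀ : Vector K (dim n) → Vector K (dim n) → K
    B₀ X Y = sum (λ i → X i * Y (opposite i))

    record Generator (p : Level) : Set (c ⊔ ℓ ⊔ lsuc p) where
      field
        subspace  : Subspace (dim n) p
        -- projective dimension n
        rank      : HasDimension subspace (suc n)
        isotropic : ∀ {u v} → Subspace.has subspace u → Subspace.has subspace v → B₀ u v ≈ 0#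

    -- O is an m-ovoid of W₀; the level p is that of the subspaces' membership predicates.
    IsOvoid : ∀ {r} (p : Level) (m : ℕ) → PointSet (dim n) r → Set (c ⊔ ℓ ⊔ r ⊔ lsuc p)
    IsOvoid p m O = (G : Generator p) → HasCardinality (O ∩ᴾ Generator.subspace G) m

    quadraticForm : K → K → Vector K (dim n) → K
    quadraticForm δ μ X =
      ellipticForm δ (X i₁) (X i₂ₙ₊₂)
      + sum (λ (j : Fin n) → X (lower j) * X (opposite (lower j)))
      + μ * ellipticForm δ (X i₂ₙ) (X i₂ₙ₊₁)

    quadraticForm-cong : ∀ δ μ {X Y : Vector K (dim n)} → X ≋ Y → quadraticForm δ μ X ≈ quadraticForm δ μ Y
    quadraticForm-cong δ μ e =
      +-cong (+-cong (ellipticForm-cong δ (e i₁) (e i₂ₙ₊₂))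
                     (sum-cong-≋ (λ (j : Fin n) → *-cong (e (lower j)) (e (opposite (lower j))))))
             (*-congˡ (ellipticForm-cong δ (e i₂ₙ) (e i₂ₙ₊₁)))

    quadraticForm-scale : ∀ δ μ a (X : Vector K (dim n)) → quadraticForm δ μ (λ i → a * X i) ≈ (a * a) * quadraticForm δ μ X
    quadraticForm-scale δ μ a X = begin
      quadraticForm δ μ (λ i → a * X i)
        ≈⟨ +-cong
             (+-cong (ellipticForm-scale δ a _ _)
                     (trans (sum-cong-≋ (λ (j : Fin n) → interchange a (X (lower j)) a (X (opposite (lower j)))))
                            (sym (*-distribˡ-sum (a * a) (λ (j : Fin n) → X (lower j) * X (opposite (lower j)))))))
             (trans (*-congˡ (ellipticForm-scale δ a _ _)) (x∙yz≈y∙xz μ (a * a) _)) ⟩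
      (a * a) * _ + (a * a) * _ + (a * a) * _
        ≈⟨ +-congʳ (sym (distribˡ (a * a) _ _)) ⟩
      (a * a) * _ + (a * a) * _
        ≈⟨ distribˡ (a * a) _ _ ⟨
      (a * a) * quadraticForm δ μ X ∎

    quadric : K → K → PointSet (dim n) ℓ
    quadric δ μ = record
      { has      = λ P → quadraticForm δ μ (proj₁ P) ≈ 0#
      ; respects = λ {P} {Q} P∼Q QP≈0 → respects-∼ (∼-sym {P = P} {Q} P∼Q) QP≈0
      }
      where
      respects-∼ : ∀ {u v : Vector K (dim n)} → ∃[ a ] a ≉ 0# × v ≋ (λ i → a * u i) →
                   quadraticForm δ μ u ≈ 0# → quadraticForm δ μ v ≈ 0#
      respects-∼ {u} (a , _ , v≋au) Qu≈0 =
        trans (quadraticForm-cong δ μ v≋au)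
          (trans (quadraticForm-scale δ μ a u) (trans (*-congˡ Qu≈0) (zeroʳ (a * a))))

{-# OPTIONS --safe #-}
module Submission where

open import Defs

-- Write β(u, v) = u_{2n} v_{2n+1} + u_{2n+1} v_{2n}. In characteristic 2 the form Q_μ polarizes to B₀ + μ β, hence to
-- μ β on a generator G. If r ∈ G lies in the radical of β|G and Q_μ(r) ≠ 0, then Q_μ(t r + v) = t² Q_μ(r) + Q_μ(v),
-- and as squaring is bijective every line of G in direction r contains exactly one zero of Q_μ: the points of 𝒬_μ in G
-- correspond to those of the projective space on G / ⟨r⟩.
-- To find r, suppose Q_μ vanishes on R = {v ∈ G : v_{2n} = v_{2n+1} = 0}. With e₂, e₃ the second and third unit vectors,
-- R + ⟨e₂, e₃⟩ is totally singular for the elliptic form Q₀, so its dimension is at most n. This forces X_{2n} and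
-- X_{2n+1} to be dependent on G, so β = 0 on G and any r ∈ G with Q_μ(r) ≠ 0 will do; there is one because
-- dim G = n + 1 and Q_μ is elliptic as well.

open import Algebra.Bundles using (CommutativeRing)
import Algebra.Definitions.RawMagma
import Algebra.Definitions.RawSemiring
import Algebra.Properties.Ring
import Algebra.Properties.Semiring.Mult
import Algebra.Properties.Semiring.Sum
import Algebra.Solver.Ring
open import Algebra.Solver.Ring.AlmostCommutativeRing using (fromCommutativeRing; Induced-equivalence; _-Raw-AlmostCommutative⟶_)
open import Data.Bool.Base using (Bool; true; false; if_then_else_)
open import Data.Bool.Properties using (xor-∧-commutativeRing)
open import Data.Fin.Base as Fin using (Fin; zero; suc; cast; finToFun; funToFin; inject₁; join; opposite; punchIn; punchOut; splitAt; toℕ; _↑ˡ_; _↑ʳ_)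
open import Data.Fin.Permutation using (Permutation′; permutation; reverse)
open import Data.Fin.Properties
  using (any?; cast-involutive; cast-is-id; finToFun-funToFin; funToFin-finToFin; join-splitAt; opposite-involutive; opposite-prop;
         pigeonhole; punchOut-injective; toℕ-cast; toℕ-injective; toℕ-inject₁; toℕ-↑ˡ; toℕ-↑ʳ; toℕ<n; <⇒≢; +↔⊎)
  renaming (_≟_ to _≟ᶠ_)
open import Data.Fin.Relation.Unary.Top using (view; ‵fromℕ; ‵inject₁)
open import Data.List.Base as List using (List; []; _∷_)
open import Data.Maybe.Base using (just; nothing)
open import Data.Nat using (ℕ; zero; suc; _≤_; _<_; _∸_; _^_; _/_; NonZero; s≤s; z≤n)
import Data.Nat.Base as ℕ
open import Data.Nat.DivMod using (m*n/n≡m)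
open import Data.Nat.Divisibility using (_∣_; ∣1⇒≡1)
open import Data.Nat.Primality using (Prime; prime[2]; euclidsLemma; prime⇒irreducible)
import Data.Nat.Properties as ℕ
open import Data.Product.Base using (Σ-syntax; ∃-syntax; _×_; _,_; proj₁; proj₂)
open import Data.Sum.Base using (_⊎_; inj₁; inj₂)
open import Data.Sum.Function.Setoid using (_⊎-inverse_)
open import Data.Sum.Relation.Binary.Pointwise using (inj₁; inj₂; _⊎ₛ_; Pointwise-≡↔≡)
open import Data.Vec.Functional using (Vector; insertAt; removeAt; tail) renaming (_∷_ to _∷ᵛ_)
open import Data.Vec.Functional.Properties using (insertAt-lookup; insertAt-punchIn)
import Data.Vec.Functional.Relation.Binary.Equality.Setoid as Pointwise
open import Function.Base using (_∘_)
open import Function.Bundles using (Inverse; Bijection)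
open import Function.Consequences.Setoid using (strictlySurjective⇒surjective)
import Function.Construct.Composition as Composition
import Function.Construct.Symmetry as Symmetry
open import Function.Definitions using (Injective)
open import Function.Properties.Bijection using (Bijection⇒Inverse)
import Level
open import Relation.Binary.Bundles using (Setoid)
open import Relation.Binary.Definitions using (Decidable; WeaklyDecidable)
open import Relation.Binary.PropositionalEquality as ≡ using (_≡_; _≗_)
import Relation.Binary.Reasoning.Setoid as ≈-Reasoning
open import Relation.Nullary using (¬_; Dec; yes; no; contradiction)
open import Relation.Nullary.Decidable using (_×-dec_; ¬?; decidable-stable; map′)

-- Parity of prime powers and maps between finite sets.

2∣p^k⇒p≡2 : ∀ {p} → Prime p → ∀ k → 2 ∣ p ^ k → p ≡ 2
2∣p^k⇒p≡2 p-prime zero 2∣1 with () ← ∣1⇒≡1 2∣1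
2∣p^k⇒p≡2 {p} p-prime (suc k) 2∣p^1+k with euclidsLemma p (p ^ k) prime[2] 2∣p^1+k
... | inj₂ 2∣p^k = 2∣p^k⇒p≡2 p-prime k 2∣p^k
... | inj₁ 2∣p with inj₂ 2≡p ← prime⇒irreducible p-prime 2∣p = ≡.sym 2≡p

-- If `f` missed `j`, then `punchOut` at `j` would turn it into an injection of a finite set into a
-- smaller one.
injective⇒surjective : ∀ {n} {f : Fin n → Fin n} → Injective _≡_ _≡_ f → ∀ j → ∃[ i ] f i ≡ j
injective⇒surjective {suc n} {f} f-inj j with any? (λ i → f i ≟ᶠ j)
... | yes found = found
... | no missed with i , k , i<k , eq ← pigeonhole (ℕ.n<1+n n) (λ i → punchOut {i = j} {f i} (missed ∘ (i ,_) ∘ ≡.sym)) =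
  contradiction (f-inj (punchOut-injective {i = j} _ _ eq)) (<⇒≢ i<k)

funToFin-cong : ∀ {m n} {f g : Fin m → Fin n} → f ≗ g → funToFin f ≡ funToFin g
funToFin-cong {zero}  f≗g = ≡.refl
funToFin-cong {suc m} f≗g = ≡.cong₂ Fin.combine (f≗g zero) (funToFin-cong (f≗g ∘ suc))

-- Arithmetic of a finite field and enumeration of its vectors.

module Field {c ℓ q} (F : FiniteField c ℓ q) where
  open FiniteField F public hiding (zero) renaming (Carrier to K)
  open Algebra.Properties.Semiring.Mult semiring using (×1-homo-*) renaming (_×_ to _·_)
  open Algebra.Properties.Semiring.Sum semiring using (sum; sum-permute; sum-cong-≋; ∑-distrib-+; sum-replicate)
  open Pointwise setoid public using (_≋_; ≋-refl; ≋-sym; ≋-trans)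
  open Inverse order public using () renaming (to to index; from to element; to-cong to index-cong)
  open ≈-Reasoning setoid

  element-index : ∀ x → element (index x) ≈ x
  element-index = Inverse.strictlyInverseʳ order

  index-element : ∀ i → index (element i) ≡ i
  index-element = Inverse.strictlyInverseˡ order

  index-injective : ∀ {x y} → index x ≡ index y → x ≈ y
  index-injective {x} {y} eq = trans (sym (element-index x)) (trans (Inverse.from-cong order eq) (element-index y))

  infix 4 _≟_
  _≟_ : Decidable _≈_
  x ≟ y = map′ index-injective index-cong (index x ≟ᶠ index y)

  -- Translation by 1 permutes K, so the sum of all elements equals itself plus q · 1.
  q·1≈0 : q · 1# ≈ 0#
  q·1≈0 = begin
    q · 1#                             ≈⟨ +-identityˡ _ ⟨
    0# + q · 1#                        ≈⟨ +-congʳ (-‿inverseˡ S) ⟨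
    (- S + S) + q · 1#                 ≈⟨ +-assoc _ _ _ ⟩
    - S + (S + q · 1#)                 ≈⟨ +-congˡ (+-congˡ (sum-replicate q)) ⟨
    - S + (S + sum {q} (λ _ → 1#))     ≈⟨ +-congˡ (∑-distrib-+ element (λ _ → 1#)) ⟨
    - S + sum (λ i → element i + 1#)   ≈⟨ +-congˡ (sum-cong-≋ (λ i → element-index (element i + 1#))) ⟨
    - S + sum (λ i → element (index (element i + 1#))) ≈⟨ +-congˡ (sum-permute element translation) ⟨
    - S + S                            ≈⟨ -‿inverseˡ S ⟩
    0#                                 ∎
    where
    S = sum element
    translation : Permutation′ q
    translation = permutation (λ i → index (element i + 1#)) (λ i → index (element i - 1#))
      (λ i → ≡.trans (index-cong (trans (+-congʳ (element-index _))
               (trans (+-assoc _ _ _) (trans (+-congˡ (-‿inverseˡ 1#)) (+-identityʳ _))))) (index-element i))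
      (λ i → ≡.trans (index-cong (trans (+-congʳ (element-index _))
               (trans (+-assoc _ _ _) (trans (+-congˡ (-‿inverseʳ 1#)) (+-identityʳ _))))) (index-element i))

  x*y≈0⇒x≈0∨y≈0 : ∀ x y → x * y ≈ 0# → x ≈ 0# ⊎ y ≈ 0#
  x*y≈0⇒x≈0∨y≈0 x y xy≈0 with x ≟ 0#
  ... | yes x≈0 = inj₁ x≈0
  ... | no x≉0 with x⁻¹ , x⁻¹x≈1 , _ ← invertible x x≉0 = inj₂ (begin
    y              ≈⟨ *-identityˡ y ⟨
    1# * y         ≈⟨ *-congʳ x⁻¹x≈1 ⟨
    x⁻¹ * x * y    ≈⟨ *-assoc _ _ _ ⟩
    x⁻¹ * (x * y)  ≈⟨ *-congˡ xy≈0 ⟩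
    x⁻¹ * 0#       ≈⟨ zeroʳ x⁻¹ ⟩
    0#             ∎)

  x*y≈0∧x≉0⇒y≈0 : ∀ {x y} → x * y ≈ 0# → x ≉ 0# → y ≈ 0#
  x*y≈0∧x≉0⇒y≈0 {x} {y} xy≈0 x≉0 with x*y≈0⇒x≈0∨y≈0 x y xy≈0
  ... | inj₁ x≈0 = contradiction x≈0 x≉0
  ... | inj₂ y≈0 = y≈0

  nonzero⇒≉0∨≉0 : ∀ {x y} → ¬ (x ≈ 0# × y ≈ 0#) → x ≉ 0# ⊎ y ≉ 0#
  nonzero⇒≉0∨≉0 {x} {y} nonzero with x ≟ 0#
  ... | no x≉0  = inj₁ x≉0
  ... | yes x≈0 = inj₂ (λ y≈0 → nonzero (x≈0 , y≈0))

  -- By `q·1≈0` the number 2^k vanishes in `K`. There are no zero divisors, so factors 2 can be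
  -- split off one at a time until one of them is zero.
  1+1≈0 : IsEvenPrimePower q → 1# + 1# ≈ 0#
  1+1≈0 ((p , k , p-prime , _ , ≡.refl) , 2∣q) with ≡.refl ← 2∣p^k⇒p≡2 p-prime k 2∣q = halve k q·1≈0
    where
    halve : ∀ k → (2 ^ k) · 1# ≈ 0# → 1# + 1# ≈ 0#
    halve zero    1≈0 = contradiction (trans (sym (+-identityʳ 1#)) 1≈0) 1≉0
    halve (suc k) eq with x*y≈0⇒x≈0∨y≈0 _ _ (trans (sym (×1-homo-* 2 (2 ^ k))) eq)
    ... | inj₁ 2≈0 = trans (+-congˡ (sym (+-identityʳ 1#))) 2≈0
    ... | inj₂ eq′ = halve k eq′

  -- A numbering of the vectors, through which the pigeonhole principle and exhaustive search apply
  -- to them.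
  encode : ∀ {d} → Vector K d → Fin (q ^ d)
  encode v = funToFin (index ∘ v)

  decode : ∀ {d} → Fin (q ^ d) → Vector K d
  decode i = element ∘ finToFun i

  decode-encode : ∀ {d} (v : Vector K d) → decode (encode v) ≋ v
  decode-encode v i = trans (Inverse.from-cong order (finToFun-funToFin (index ∘ v) i)) (element-index (v i))

  encode-cong : ∀ {d} {u v : Vector K d} → u ≋ v → encode u ≡ encode v
  encode-cong u≋v = funToFin-cong (λ i → index-cong (u≋v i))

  encode-decode : ∀ {d} (i : Fin (q ^ d)) → encode (decode {d} i) ≡ i
  encode-decode {d} i = ≡.trans (funToFin-cong (λ l → index-element (finToFun {q} {d} i l))) (funToFin-finToFin {d} i)

  encode-injective : ∀ {d} (u v : Vector K d) → encode u ≡ encode v → u ≋ v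
  encode-injective u v eq i = trans (sym (decode-encode u i))
    (trans (reflexive (≡.cong (λ e → decode e i) eq)) (decode-encode v i))

-- Characteristic 2: squaring and kernels of additive functionals.

module Characteristic2 {c ℓ q} (F : FiniteField c ℓ q) (q-even : IsEvenPrimePower q) where
  open Field F public
  open Algebra.Properties.Ring ring using (-0#≈0#)
  open ≈-Reasoning setoid

  private
    coefficient : Bool → K
    coefficient b = if b then 1# else 0#

    morphism : CommutativeRing.rawRing xor-∧-commutativeRing -Raw-AlmostCommutative⟶ fromCommutativeRing commutativeRing
    morphism = record
      { ⟦_⟧    = coefficient
      ; +-homo = λ { false b → sym (+-identityˡ _)
                   ; true false → sym (+-identityʳ _)
                   ; true true → sym (1+1≈0 q-even) }
      ; *-homo = λ { false b → sym (zeroˡ _)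
                   ; true b → sym (*-identityˡ _) }
      ; -‿homo = λ { false → sym -0#≈0#
                   ; true → begin
                       1#              ≈⟨ +-identityʳ 1# ⟨
                       1# + 0#         ≈⟨ +-congˡ (-‿inverseʳ 1#) ⟨
                       1# + (1# - 1#)  ≈⟨ +-assoc _ _ _ ⟨
                       1# + 1# - 1#    ≈⟨ +-congʳ (1+1≈0 q-even) ⟩
                       0# - 1#         ≈⟨ +-identityˡ _ ⟩
                       - 1#            ∎ }
      ; 0-homo = refl
      ; 1-homo = refl
      }

    coefficient≟ : WeaklyDecidable (Induced-equivalence morphism)
    coefficient≟ false false = just refl
    coefficient≟ true  true  = just refl
    coefficient≟ _     _     = nothing

  -- With coefficients in the prime field 𝔽₂, the ring solver proves the identities that hold in characteristic 2.
  open Algebra.Solver.Ring (CommutativeRing.rawRing xor-∧-commutativeRing) (fromCommutativeRing commutativeRing) morphism coefficient≟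
    public using (solve; _:=_; _:+_; _:*_; con)

  x+x≈0 : ∀ x → x + x ≈ 0#
  x+x≈0 = solve 1 (λ x → x :+ x := con false) refl

  x+y≈0⇒x≈y : ∀ {x y} → x + y ≈ 0# → x ≈ y
  x+y≈0⇒x≈y {x} {y} eq = begin
    x            ≈⟨ solve 2 (λ x y → x := (x :+ y) :+ y) refl x y ⟩
    (x + y) + y  ≈⟨ +-congʳ eq ⟩
    0# + y       ≈⟨ +-identityˡ y ⟩
    y            ∎

  x*x≈0⇒x≈0 : ∀ {x} → x * x ≈ 0# → x ≈ 0#
  x*x≈0⇒x≈0 {x} eq with x*y≈0⇒x≈0∨y≈0 x x eq
  ... | inj₁ x≈0 = x≈0
  ... | inj₂ x≈0 = x≈0

  -- Squaring is additive here, so its injectivity comes down to the absence of nilpotent elements.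
  x*x≈y*y⇒x≈y : ∀ {x y} → x * x ≈ y * y → x ≈ y
  x*x≈y*y⇒x≈y {x} {y} eq = x+y≈0⇒x≈y (x*x≈0⇒x≈0 (begin
    (x + y) * (x + y)  ≈⟨ solve 2 (λ x y → (x :+ y) :* (x :+ y) := x :* x :+ y :* y) refl x y ⟩
    x * x + y * y      ≈⟨ +-congʳ eq ⟩
    y * y + y * y      ≈⟨ x+x≈0 _ ⟩
    0#                 ∎))

  abstract
    -- Squaring is injective, and an injective self-map of a finite set is onto.
    squareRoot : ∀ y → ∃[ x ] x * x ≈ y
    squareRoot y with i , eq ← injective⇒surjective
        {f = λ i → index (element i * element i)}
        (λ {i} {j} eq → ≡.trans (≡.sym (index-element i))
          (≡.trans (index-cong (x*x≈y*y⇒x≈y (index-injective eq))) (index-element j)))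
        (index y)
      = element i , index-injective eq

  infixl 6 _+ᵛ_
  _+ᵛ_ : ∀ {d} → Vector K d → Vector K d → Vector K d
  (u +ᵛ v) i = u i + v i

  infixl 7 _*ᵛ_
  _*ᵛ_ : ∀ {d} → K → Vector K d → Vector K d
  (a *ᵛ v) i = a * v i

  0ᵛ : ∀ {d} → Vector K d
  0ᵛ _ = 0#

  -- Functionals are taken as additive maps because their common zeros are found by counting, not by
  -- elimination.
  record Additive (d : ℕ) : Set (c Level.⊔ ℓ) where
    field
      ⟦_⟧    : Vector K d → K
      +-homo : ∀ u v → ⟦ u +ᵛ v ⟧ ≈ ⟦ u ⟧ + ⟦ v ⟧

  open Additive public

  Kernel : ∀ {k d} → Vector (Additive d) k → Vector K d → Set ℓ
  Kernel L v = ∀ i → ⟦ L i ⟧ v ≈ 0#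

  1<q : 1 < q
  1<q = primePower>1 (proj₁ q-even)

  -- The q^d vectors have at most q^k images, so two distinct vectors collide. Their difference,
  -- which in characteristic 2 is their sum, lies in the kernel.
  kernel-nontrivial : ∀ {k d} → k < d → (L : Vector (Additive d) k) → ∃[ v ] ¬ v ≋ 0ᵛ × Kernel L v
  kernel-nontrivial {k} {d} k<d L
    with i , j , i<j , eq ← pigeonhole (ℕ.^-monoʳ-< q 1<q k<d) (λ i → encode (λ l → ⟦ L l ⟧ (decode i))) =
      decode {d} i +ᵛ decode {d} j
    , (λ v≈0 → <⇒≢ i<j (≡.trans (≡.sym (encode-decode {d} i))
        (≡.trans (encode-cong (λ l → x+y≈0⇒x≈y (v≈0 l))) (encode-decode {d} j))))
    , λ l → trans (+-homo (L l) _ _) (trans (+-congˡ (sym (collision l))) (x+x≈0 _))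
    where
    collision : (λ l → ⟦ L l ⟧ (decode {d} i)) ≋ (λ l → ⟦ L l ⟧ (decode {d} j))
    collision = encode-injective _ _ eq

-- The anisotropic binary form and totally singular subspaces.

module AnisotropicForm {c ℓ q} (F : FiniteField c ℓ q) (q-even : IsEvenPrimePower q) where
  open Characteristic2 F q-even public
  open Algebra.Properties.Semiring.Sum semiring using (sum; sum-cong-≋)
  open ≈-Reasoning setoid

  evaluate : List K → K → K
  evaluate []       z = 0#
  evaluate (a ∷ as) z = a + z * evaluate as z

  -- Lists for the same polynomial may differ in length, so an exhausted list is compared with the
  -- zeros that end the other one.
  evaluate-cong : ∀ as bs → (∀ i → coeff F as i ≈ coeff F bs i) → ∀ z → evaluate as z ≈ evaluate bs z
  evaluate-cong []       []       eq z = refl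
  evaluate-cong []       (b ∷ bs) eq z = begin
    0#                       ≈⟨ solve 1 (λ z → con false := con false :+ z :* con false) refl z ⟩
    0# + z * 0#              ≈⟨ +-cong (eq 0) (*-congˡ (evaluate-cong [] bs (eq ∘ suc) z)) ⟩
    b + z * evaluate bs z    ∎
  evaluate-cong (a ∷ as) []       eq z = begin
    a + z * evaluate as z    ≈⟨ +-cong (eq 0) (*-congˡ (evaluate-cong as [] (eq ∘ suc) z)) ⟩
    0# + z * 0#              ≈⟨ solve 1 (λ z → con false :+ z :* con false := con false) refl z ⟩
    0#                       ∎
  evaluate-cong (a ∷ as) (b ∷ bs) eq z = +-cong (eq 0) (*-congˡ (evaluate-cong as bs (eq ∘ suc) z))

  evaluate-+ : ∀ as bs z → evaluate (_+ᴾ_ F as bs) z ≈ evaluate as z + evaluate bs z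
  evaluate-+ []       bs       z = sym (+-identityˡ _)
  evaluate-+ (a ∷ as) []       z = sym (+-identityʳ _)
  evaluate-+ (a ∷ as) (b ∷ bs) z = begin
    (a + b) + z * evaluate (_+ᴾ_ F as bs) z              ≈⟨ +-congˡ (*-congˡ (evaluate-+ as bs z)) ⟩
    (a + b) + z * (evaluate as z + evaluate bs z)
      ≈⟨ solve 5 (λ a b z x y → (a :+ b) :+ z :* (x :+ y) := (a :+ z :* x) :+ (b :+ z :* y)) refl a b z _ _ ⟩
    (a + z * evaluate as z) + (b + z * evaluate bs z)    ∎

  evaluate-scale : ∀ a bs z → evaluate (List.map (a *_) bs) z ≈ a * evaluate bs z
  evaluate-scale a []       z = sym (zeroʳ a)
  evaluate-scale a (b ∷ bs) z = begin
    a * b + z * evaluate (List.map (a *_) bs) z  ≈⟨ +-congˡ (*-congˡ (evaluate-scale a bs z)) ⟩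
    a * b + z * (a * evaluate bs z)
      ≈⟨ solve 4 (λ a b z x → a :* b :+ z :* (a :* x) := a :* (b :+ z :* x)) refl a b z _ ⟩
    a * (b + z * evaluate bs z)                  ∎

  evaluate-* : ∀ as bs z → evaluate (_*ᴾ_ F as bs) z ≈ evaluate as z * evaluate bs z
  evaluate-* []       bs z = sym (zeroˡ _)
  evaluate-* (a ∷ as) bs z = begin
    evaluate (_+ᴾ_ F (List.map (a *_) bs) (0# ∷ _*ᴾ_ F as bs)) z
      ≈⟨ evaluate-+ (List.map (a *_) bs) _ z ⟩
    evaluate (List.map (a *_) bs) z + (0# + z * evaluate (_*ᴾ_ F as bs) z)
      ≈⟨ +-cong (evaluate-scale a bs z) (+-congˡ (*-congˡ (evaluate-* as bs z))) ⟩
    a * evaluate bs z + (0# + z * (evaluate as z * evaluate bs z))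
      ≈⟨ solve 4 (λ a z x y → a :* y :+ (con false :+ z :* (x :* y)) := (a :+ z :* x) :* y) refl a z _ _ ⟩
    (a + z * evaluate as z) * evaluate bs z  ∎

  module Irreducibility = Algebra.Definitions.RawSemiring (K[X] F)

  -- In characteristic 2 the polynomial `a + X` has the root `a`, whereas a divisor of 1 has no
  -- root.
  linear∤1 : ∀ a → ¬ ((a ∷ 1# ∷ []) Irreducibility.∣ (1# ∷ []))
  linear∤1 a (Algebra.Definitions.RawMagma._,_ bs eq) = 1≉0 (begin
    1#                                                ≈⟨ solve 1 (λ a → con true := con true :+ a :* con false) refl a ⟩
    evaluate (1# ∷ []) a                              ≈⟨ evaluate-cong (_*ᴾ_ F bs (a ∷ 1# ∷ [])) (1# ∷ []) eq a ⟨
    evaluate (_*ᴾ_ F bs (a ∷ 1# ∷ [])) a              ≈⟨ evaluate-* bs (a ∷ 1# ∷ []) a ⟩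
    evaluate bs a * (a + a * (1# + a * 0#))
      ≈⟨ solve 2 (λ x a → x :* (a :+ a :* (con true :+ a :* con false)) := con false) refl (evaluate bs a) a ⟩
    0#                                                ∎)

  infix 8 _⁻¹
  _⁻¹ : K → K
  x ⁻¹ with x ≟ 0#
  -- A default value; the inverse law is stated for `x ≉ 0#`.
  ... | yes _   = 0#
  ... | no x≉0 = proj₁ (invertible x x≉0)

  ⁻¹-inverseˡ : ∀ {x} → x ≉ 0# → x ⁻¹ * x ≈ 1#
  ⁻¹-inverseˡ {x} x≉0 with x ≟ 0#
  ... | yes x≈0 = contradiction x≈0 x≉0
  ... | no x≉0′ = proj₁ (proj₂ (invertible x x≉0′))

  *-cancelʳ : ∀ {x y z} → z ≉ 0# → x * z ≈ y * z → x ≈ y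
  *-cancelʳ {x} {y} {z} z≉0 eq with x*y≈0⇒x≈0∨y≈0 (x + y) z (begin
      (x + y) * z    ≈⟨ distribʳ z x y ⟩
      x * z + y * z  ≈⟨ +-congʳ eq ⟩
      y * z + y * z  ≈⟨ x+x≈0 _ ⟩
      0#             ∎)
  ... | inj₁ x+y≈0 = x+y≈0⇒x≈y x+y≈0
  ... | inj₂ z≈0   = contradiction z≈0 z≉0

  module _ {δ} (irreducible : IsIrreducibleX²+X+ F δ) where

    -- In characteristic 2 a root `z` gives the factorization (X + z)(X + z + 1), in which neither
    -- factor is a unit.
    X²+X+δ-rootfree : ∀ z → z * z + z + δ ≉ 0#
    X²+X+δ-rootfree z root
      with Irreducibility.Irreducible.split-∣1 irreducible {z ∷ 1# ∷ []} {(z + 1#) ∷ 1# ∷ []} factors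
      where
      factors : ∀ i → coeff F (δ ∷ 1# ∷ 1# ∷ []) i ≈ coeff F (_*ᴾ_ F (z ∷ 1# ∷ []) ((z + 1#) ∷ 1# ∷ [])) i
      factors 0 = begin
        δ                      ≈⟨ x+y≈0⇒x≈y root ⟨
        z * z + z              ≈⟨ solve 1 (λ z → z :* z :+ z := z :* (z :+ con true) :+ con false) refl z ⟩
        z * (z + 1#) + 0#      ∎
      factors 1 = solve 1 (λ z → con true := z :* con true :+ (con true :* (z :+ con true) :+ con false)) refl z
      factors 2 = sym (*-identityˡ 1#)
      factors (suc (suc (suc i))) = refl
    ... | inj₁ unit = linear∤1 z unit
    ... | inj₂ unit = linear∤1 (z + 1#) unit

    -- For y ≠ 0, dividing by y² turns a zero of the form into the root x/y of X² + X + δ; for y = 0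
    -- the form is x².
    ellipticForm-anisotropic : ∀ {x y} → ellipticForm F δ x y ≈ 0# → x ≈ 0# × y ≈ 0#
    ellipticForm-anisotropic {x} {y} eq with y ≟ 0#
    ... | yes y≈0 = x*x≈0⇒x≈0 (begin
      x * x                    ≈⟨ solve 2 (λ x δ → x :* x := x :* x :+ x :* con false :+ δ :* (con false :* con false)) refl x δ ⟩
      ellipticForm F δ x 0#    ≈⟨ ellipticForm-cong F δ refl y≈0 ⟨
      ellipticForm F δ x y     ≈⟨ eq ⟩
      0#                       ∎) , y≈0
    ... | no y≉0 = contradiction (begin
      z * z + z + δ                  ≈⟨ solve 2 (λ z δ → z :* z :+ z :+ δ := z :* z :+ z :* con true :+ δ :* (con true :* con true)) refl z δ ⟩
      ellipticForm F δ z 1#          ≈⟨ ellipticForm-cong F δ refl (⁻¹-inverseˡ y≉0) ⟨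
      ellipticForm F δ (y ⁻¹ * x) (y ⁻¹ * y) ≈⟨ ellipticForm-scale F δ (y ⁻¹) x y ⟩
      (y ⁻¹ * y ⁻¹) * ellipticForm F δ x y ≈⟨ *-congˡ eq ⟩
      (y ⁻¹ * y ⁻¹) * 0#             ≈⟨ zeroʳ _ ⟩
      0#                             ∎) (X²+X+δ-rootfree z)
      where z = y ⁻¹ * x

    -- The conclusion drawn from a totally singular kernel that is too large. Where the functionals
    -- determine a vector completely, such an `a` is a non-trivial linear relation.
    CommonZero : ∀ {m k d} → Vector (Additive d) k → (x y : Additive d) → (u w : Vector (Additive d) m) → Set (c Level.⊔ ℓ)
    CommonZero L x y u w = ∃[ a ] ¬ a ≋ 0ᵛ × Kernel L a × ⟦ x ⟧ a ≈ 0# × ⟦ y ⟧ a ≈ 0# × Kernel u a × Kernel w a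

    Singular : ∀ {m d} → (x y : Additive d) → (u w : Vector (Additive d) m) → Vector K d → Set ℓ
    Singular x y u w a = ellipticForm F δ (⟦ x ⟧ a) (⟦ y ⟧ a) + sum (λ j → ⟦ u j ⟧ a * ⟦ w j ⟧ a) ≈ 0#

    abstract
      -- The additive functionals need not be independent, and L cuts out a subspace: a quadratic form
      -- N(x, y) + Σ uⱼ wⱼ with m hyperbolic pairs has no totally singular subspace of dimension m + 1.
      common-zero : ∀ m {k d} → m ℕ.+ k < d → (L : Vector (Additive d) k) (x y : Additive d) (u w : Vector (Additive d) m) →
        (∀ a → Kernel L a → Singular x y u w a) → CommonZero L x y u w
      common-zero zero k<d L x y u w singular
        with a , a≉0 , La≈0 ← kernel-nontrivial k<d L
        with xa≈0 , ya≈0 ← ellipticForm-anisotropic (trans (sym (+-identityʳ _)) (singular a La≈0))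
        = a , a≉0 , La≈0 , xa≈0 , ya≈0 , (λ ()) , (λ ())
      common-zero (suc m) {k} {d} 1+m+k<d L x y u w singular = extend
        -- On the hyperplane w₀ = 0 the first pair contributes nothing, so induction applies with
        -- one pair fewer and one constraint more.
        (common-zero m m+1+k<d (w zero ∷ᵛ L) x y (u ∘ suc) (w ∘ suc)
          (λ a La≈0 → drop (trans (*-congˡ (La≈0 zero)) (zeroʳ _)) (singular a (La≈0 ∘ suc))))
        where
        m+1+k<d : m ℕ.+ suc k < d
        m+1+k<d = ≡.subst (_< d) (≡.sym (ℕ.+-suc m k)) 1+m+k<d
        drop : ∀ {e p s} → p ≈ 0# → e + (p + s) ≈ 0# → e + s ≈ 0#
        drop p≈0 eq = trans (+-congˡ (sym (trans (+-congʳ p≈0) (+-identityˡ _)))) eq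
        extend : CommonZero (w zero ∷ᵛ L) x y (u ∘ suc) (w ∘ suc) → CommonZero L x y u w
        extend (a , a≉0 , La≈0 , xa≈0 , ya≈0 , ua≈0 , wa≈0) with ⟦ u zero ⟧ a ≟ 0#
        ... | yes u₀a≈0 = a , a≉0 , La≈0 ∘ suc , xa≈0 , ya≈0 ,
          (λ { zero → u₀a≈0 ; (suc j) → ua≈0 j }) , (λ { zero → La≈0 zero ; (suc j) → wa≈0 j })
        -- Polarizing at a, where only u₀ is non-zero, shows that w₀ vanishes on the kernel of L.
        ... | no u₀a≉0 = adjoin-w₀ (common-zero m m+1+k<d (u zero ∷ᵛ L) x y (u ∘ suc) (w ∘ suc)
              (λ b Lb≈0 → drop (trans (*-congʳ (Lb≈0 zero)) (zeroˡ _)) (singular b (Lb≈0 ∘ suc))))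
          where
          shift : ∀ (f : Additive d) b → ⟦ f ⟧ a ≈ 0# → ⟦ f ⟧ (a +ᵛ b) ≈ ⟦ f ⟧ b
          shift f b fa≈0 = trans (+-homo f a b) (trans (+-congʳ fa≈0) (+-identityˡ _))
          polarize : ∀ b → Kernel L b → ⟦ u zero ⟧ a * ⟦ w zero ⟧ b ≈ 0#
          polarize b Lb≈0 = begin
            u₀ * w₀
              ≈⟨ solve 5 (λ u₀ v₀ w₀ e s → u₀ :* w₀ := (e :+ ((u₀ :+ v₀) :* w₀ :+ s)) :+ (e :+ (v₀ :* w₀ :+ s))) refl u₀ v₀ w₀ e s ⟩
            (e + ((u₀ + v₀) * w₀ + s)) + (e + (v₀ * w₀ + s))
              ≈⟨ +-congʳ (+-cong (ellipticForm-cong F δ (shift x b xa≈0) (shift y b ya≈0))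
                   (+-cong (*-cong (+-homo (u zero) a b) (shift (w zero) b (La≈0 zero)))
                     (sum-cong-≋ (λ j → *-cong (shift (u (suc j)) b (ua≈0 j)) (shift (w (suc j)) b (wa≈0 j)))))) ⟨
            ellipticForm F δ (⟦ x ⟧ (a +ᵛ b)) (⟦ y ⟧ (a +ᵛ b)) + sum (λ j → ⟦ u j ⟧ (a +ᵛ b) * ⟦ w j ⟧ (a +ᵛ b)) + (e + (v₀ * w₀ + s))
              ≈⟨ +-cong (singular (a +ᵛ b) (λ i → trans (+-homo (L i) a b) (trans (+-cong (La≈0 (suc i)) (Lb≈0 i)) (+-identityˡ 0#)))) (singular b Lb≈0) ⟩
            0# + 0#  ≈⟨ +-identityˡ 0# ⟩
            0#       ∎
            where
            u₀ v₀ w₀ e s : K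
            u₀ = ⟦ u zero ⟧ a
            v₀ = ⟦ u zero ⟧ b
            w₀ = ⟦ w zero ⟧ b
            e = ellipticForm F δ (⟦ x ⟧ b) (⟦ y ⟧ b)
            s = sum (λ j → ⟦ u (suc j) ⟧ b * ⟦ w (suc j) ⟧ b)
          adjoin-w₀ : CommonZero (u zero ∷ᵛ L) x y (u ∘ suc) (w ∘ suc) → CommonZero L x y u w
          adjoin-w₀ (b , b≉0 , Lb≈0 , xb≈0 , yb≈0 , ub≈0 , wb≈0) = b , b≉0 , Lb≈0 ∘ suc , xb≈0 , yb≈0 ,
            (λ { zero → Lb≈0 zero ; (suc j) → ub≈0 j }) ,
            (λ { zero → x*y≈0∧x≉0⇒y≈0 (polarize b (Lb≈0 ∘ suc)) u₀a≉0 ; (suc j) → wb≈0 j })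

-- The number of points of a projective space.

-- The geometric sum 1 + q + ... + q^(m-1), indexed by the vector space dimension. The recursion
-- mirrors the splitting of a projective space into an affine part and a hyperplane.
pointCount : ℕ → ℕ → ℕ
pointCount q zero    = 0
pointCount q (suc m) = q ^ m ℕ.+ pointCount q m

-- Multiplied by q - 1 the sum telescopes; the bounds 1 ≤ q^m ≤ q^(m+1) make the truncated
-- subtractions exact.
pointCount≡ : ∀ {q} (1<q : 1 < q) .{{_ : NonZero (q ∸ 1)}} m → pointCount q m ≡ (q ^ m ∸ 1) ℕ./ (q ∸ 1)
pointCount≡ {q} 1<q m = ≡.trans (≡.sym (m*n/n≡m (pointCount q m) (q ∸ 1))) (≡.cong (ℕ._/ (q ∸ 1)) (telescope m))
  where
  telescope : ∀ m → pointCount q m ℕ.* (q ∸ 1) ≡ q ^ m ∸ 1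
  telescope zero    = ≡.refl
  telescope (suc m) = begin
    (q ^ m ℕ.+ pointCount q m) ℕ.* (q ∸ 1)            ≡⟨ ℕ.*-distribʳ-+ (q ∸ 1) (q ^ m) _ ⟩
    q ^ m ℕ.* (q ∸ 1) ℕ.+ pointCount q m ℕ.* (q ∸ 1)  ≡⟨ ≡.cong₂ ℕ._+_ (ℕ.*-distribˡ-∸ (q ^ m) q 1) (telescope m) ⟩
    (q ^ m ℕ.* q ∸ q ^ m ℕ.* 1) ℕ.+ (q ^ m ∸ 1)       ≡⟨ ≡.cong₂ (λ a b → (a ∸ b) ℕ.+ (q ^ m ∸ 1)) (ℕ.*-comm (q ^ m) q) (ℕ.*-identityʳ (q ^ m)) ⟩
    (q ^ suc m ∸ q ^ m) ℕ.+ (q ^ m ∸ 1)               ≡⟨ ℕ.+-∸-assoc _ 1≤q^m ⟨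
    (q ^ suc m ∸ q ^ m) ℕ.+ q ^ m ∸ 1                 ≡⟨ ≡.cong (_∸ 1) (ℕ.m∸n+n≡m (ℕ.^-monoʳ-≤ q {{q≢0}} (ℕ.n≤1+n m))) ⟩
    q ^ suc m ∸ 1                                     ∎
    where
    open ≡.≡-Reasoning
    q≢0 : NonZero q
    q≢0 = ℕ.>-nonZero (ℕ.<-trans (ℕ.n<1+n 0) 1<q)
    1≤q^m : 1 ≤ q ^ m
    1≤q^m = ℕ.m^n>0 q {{q≢0}} m

-- Points of projective spaces, linear combinations and exchange of basis vectors.

module Projective {c ℓ q} (F : FiniteField c ℓ q) (q-even : IsEvenPrimePower q) where
  open AnisotropicForm F q-even public
  open Algebra.Properties.Semiring.Sum semiring using (sum; sum-cong-≋; ∑-distrib-+; *-distribˡ-sum; sum-remove; sum-replicate-zero)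
  open ≈-Reasoning setoid

  private
    vectors : ℕ → Setoid c ℓ
    vectors m = Pointwise.≋-setoid setoid m

    x≉0⇒x⁻¹≉0 : ∀ {x} → x ≉ 0# → x ⁻¹ ≉ 0#
    x≉0⇒x⁻¹≉0 {x} x≉0 x⁻¹≈0 = 1≉0 (trans (sym (⁻¹-inverseˡ x≉0)) (trans (*-congʳ x⁻¹≈0) (zeroˡ x)))

  vectorCount : ∀ m → HasCardinality (vectors m) (q ^ m)
  vectorCount m = record
    { to        = encode
    ; from      = decode
    ; to-cong   = encode-cong
    ; from-cong = λ { ≡.refl → ≋-refl }
    ; inverse   = (λ {i} v≋i → ≡.trans (encode-cong v≋i) (encode-decode {m} i)) , λ { {v} ≡.refl → decode-encode v }
    }

  -- A point of PG(m, q) has a unique representative whose first non-zero coordinate is 1.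
  affine⊎hyperplane : ∀ m → Bijection (vectors m ⊎ₛ PG F m) (PG F (suc m))
  affine⊎hyperplane m = record
    { to        = to
    ; cong      = λ {s} {t} → to-cong {s} {t}
    ; bijective = (λ {s} {t} → injective {s} {t}) ,
        strictlySurjective⇒surjective (vectors m ⊎ₛ PG F m) (PG F (suc m)) {to} (λ {s} {t} → to-cong {s} {t}) surjective
    }
    where
    open Setoid (vectors m ⊎ₛ PG F m) using () renaming (Carrier to A; _≈_ to _≈ᴬ_)
    open Setoid (PG F (suc m)) using () renaming (_≈_ to _≈ᴾ_)
    to : A → Point F (suc m)
    to (inj₁ w)         = 1# ∷ᵛ w , λ eq → 1≉0 (eq zero)
    to (inj₂ (w , w≉0)) = 0# ∷ᵛ w , λ eq → w≉0 (eq ∘ suc)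
    to-cong : ∀ {s t} → s ≈ᴬ t → to s ≈ᴾ to t
    to-cong (inj₁ eq) = 1# , 1≉0 , λ { zero → sym (*-identityˡ 1#) ; (suc i) → trans (eq i) (sym (*-identityˡ _)) }
    to-cong (inj₂ (a , a≉0 , eq)) = a , a≉0 , λ { zero → sym (zeroʳ a) ; (suc i) → eq i }
    injective : ∀ {s t} → to s ≈ᴾ to t → s ≈ᴬ t
    injective {inj₁ u} {inj₁ v} (a , a≉0 , eq) =
      inj₁ (λ i → trans (eq (suc i)) (trans (*-congʳ (trans (sym (*-identityʳ a)) (sym (eq zero)))) (*-identityˡ _)))
    injective {inj₁ u} {inj₂ v} (a , a≉0 , eq) = contradiction (trans (eq zero) (zeroʳ a)) 1≉0
    injective {inj₂ u} {inj₁ v} (a , a≉0 , eq) = contradiction (sym (trans (eq zero) (*-identityʳ a))) a≉0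
    injective {inj₂ u} {inj₂ v} (a , a≉0 , eq) = inj₂ (a , a≉0 , eq ∘ suc)
    surjective : ∀ P → ∃[ s ] to s ≈ᴾ P
    surjective (v , v≉0) with v zero ≟ 0#
    ... | yes v₀≈0 = inj₂ (tail v , λ eq → v≉0 (λ { zero → v₀≈0 ; (suc i) → eq i })) ,
      1# , 1≉0 , λ { zero → sym (trans (*-identityˡ _) v₀≈0) ; (suc i) → sym (*-identityˡ _) }
    ... | no v₀≉0 = inj₁ (v zero ⁻¹ *ᵛ tail v) ,
      v zero ⁻¹ , x≉0⇒x⁻¹≉0 v₀≉0 , λ { zero → sym (⁻¹-inverseˡ v₀≉0) ; (suc i) → refl }

  points : ∀ m → HasCardinality (PG F m) (pointCount q m)
  -- The only vector of length 0 is zero, so there is no point.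
  points zero    = record
    { to        = λ (_ , v≉0) → contradiction (λ ()) v≉0
    ; from      = λ ()
    ; to-cong   = λ { {_ , v≉0} → contradiction (λ ()) v≉0 }
    ; from-cong = λ { {()} }
    ; inverse   = (λ { {()} }) , λ { {_ , v≉0} → contradiction (λ ()) v≉0 }
    }
  points (suc m) = Composition.inverse (Symmetry.inverse (Bijection⇒Inverse (affine⊎hyperplane m)))
    (Composition.inverse (vectorCount m ⊎-inverse points m)
    (Composition.inverse (Pointwise-≡↔≡ _ _) (Symmetry.inverse +↔⊎)))

  module _ {N d} (b : Vector (Vector K N) d) where

    combination-cong : ∀ {u v} → u ≋ v → combination F u b ≋ combination F v b
    combination-cong u≋v i = sum-cong-≋ (λ j → *-congʳ (u≋v j))

    combination-+ : ∀ u v → combination F (u +ᵛ v) b ≋ combination F u b +ᵛ combination F v b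
    combination-+ u v i = trans (sum-cong-≋ (λ j → distribʳ (b j i) (u j) (v j))) (∑-distrib-+ (λ j → u j * b j i) (λ j → v j * b j i))

    combination-* : ∀ a v → combination F (a *ᵛ v) b ≋ a *ᵛ combination F v b
    combination-* a v i = trans (sum-cong-≋ (λ j → *-assoc a (v j) (b j i))) (sym (*-distribˡ-sum a (λ j → v j * b j i)))

    combination-0 : combination F 0ᵛ b ≋ 0ᵛ
    combination-0 i = trans (sum-cong-≋ (λ j → zeroˡ (b j i))) (sum-replicate-zero d)

    combination-injective : (∀ a → combination F a b ≋ 0ᵛ → a ≋ 0ᵛ) → ∀ {u v} → combination F u b ≋ combination F v b → u ≋ v
    combination-injective independent {u} {v} eq j = x+y≈0⇒x≈y (independent (u +ᵛ v)
      (λ i → trans (combination-+ u v i) (trans (+-congʳ (eq i)) (x+x≈0 _))) j)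

  combination-remove : ∀ {N d} (b : Vector (Vector K N) (suc d)) k v → v k ≈ 0# →
    combination F v b ≋ combination F (removeAt v k) (removeAt b k)
  combination-remove b k v vₖ≈0 i = begin
    sum (λ j → v j * b j i)                                 ≈⟨ sum-remove {i = k} (λ j → v j * b j i) ⟩
    v k * b k i + combination F (removeAt v k) (removeAt b k) i ≈⟨ +-congʳ (trans (*-congʳ vₖ≈0) (zeroˡ _)) ⟩
    0# + combination F (removeAt v k) (removeAt b k) i          ≈⟨ +-identityˡ _ ⟩
    combination F (removeAt v k) (removeAt b k) i               ∎

  module _ {N p} (U : Subspace F N p) where
    open Subspace U

    combination-closed : ∀ {d} (b : Vector (Vector K N) d) → (∀ j → has (b j)) → ∀ a → has (combination F a b)
    combination-closed {zero}  b b∈U a = 0-closed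
    combination-closed {suc d} b b∈U a = +-closed (*-closed (a zero) (b∈U zero)) (combination-closed (b ∘ suc) (b∈U ∘ suc) (a ∘ suc))

    -- The Steinitz exchange of a basis vector for r.
    extendToBasis : ∀ {d} → HasDimension F U (suc d) → ∀ {r} → has r → ¬ r ≋ 0ᵛ →
      Σ[ D ∈ HasDimension F U (suc d) ] HasDimension.basis D zero ≡ r
    extendToBasis {d} D {r} r∈U r≉0 = exchange (nonzero-coordinate ρ ρ≉0)
      where
      open HasDimension D renaming (basis to b)
      ρ : Vector K (suc d)
      ρ = proj₁ (spanning r∈U)
      r≋ρb : r ≋ combination F ρ b
      r≋ρb = proj₂ (spanning r∈U)
      ρ≉0 : ¬ ρ ≋ 0ᵛ
      ρ≉0 ρ≈0 = r≉0 (≋-trans r≋ρb (≋-trans (combination-cong b ρ≈0) (combination-0 b)))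
      nonzero-coordinate : ∀ {d} (v : Vector K d) → ¬ v ≋ 0ᵛ → ∃[ k ] v k ≉ 0#
      nonzero-coordinate {zero}  v v≉0 = contradiction (λ ()) v≉0
      nonzero-coordinate {suc d} v v≉0 with v zero ≟ 0#
      ... | no v₀≉0 = zero , v₀≉0
      ... | yes v₀≈0 with k , vₖ≉0 ← nonzero-coordinate (tail v) (λ eq → v≉0 (λ { zero → v₀≈0 ; (suc i) → eq i })) = suc k , vₖ≉0
      exchange : ∃[ k ] ρ k ≉ 0# → _
      exchange (k , ρₖ≉0) = record
        { basis       = b′
        ; inside      = λ { zero → r∈U ; (suc j) → inside (punchIn k j) }
        ; independent = independent′
        ; spanning    = spanning′
        } , ≡.refl
        where
        b′ = r ∷ᵛ removeAt b k
        -- the coordinates with respect to b of a vector given by its coordinates with respect to b′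
        old : Vector K (suc d) → Vector K (suc d)
        old a = (a zero *ᵛ ρ) +ᵛ insertAt (tail a) k 0#
        old-combination : ∀ a → combination F a b′ ≋ combination F (old a) b
        old-combination a i = begin
          a zero * r i + combination F (tail a) (removeAt b k) i
            ≈⟨ +-cong (*-congˡ (r≋ρb i)) (sum-cong-≋ (λ j → *-congʳ (reflexive (≡.sym (insertAt-punchIn (tail a) k 0# j))))) ⟩
          a zero * combination F ρ b i + combination F (removeAt (insertAt (tail a) k 0#) k) (removeAt b k) i
            ≈⟨ +-cong (combination-* b (a zero) ρ i) (combination-remove b k (insertAt (tail a) k 0#) (reflexive (insertAt-lookup (tail a) k 0#)) i) ⟨
          combination F (a zero *ᵛ ρ) b i + combination F (insertAt (tail a) k 0#) b i
            ≈⟨ combination-+ b (a zero *ᵛ ρ) (insertAt (tail a) k 0#) i ⟨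
          combination F (old a) b i ∎
        independent′ : ∀ a → combination F a b′ ≋ 0ᵛ → a ≋ 0ᵛ
        independent′ a eq = λ { zero → a₀≈0 ; (suc j) → begin
            a (suc j)                     ≈⟨ reflexive (insertAt-punchIn (tail a) k 0# j) ⟨
            insertAt (tail a) k 0# (punchIn k j) ≈⟨ trans (+-congʳ (trans (*-congʳ a₀≈0) (zeroˡ _))) (+-identityˡ _) ⟨
            old a (punchIn k j)           ≈⟨ old≈0 (punchIn k j) ⟩
            0#                            ∎ }
          where
          old≈0 : old a ≋ 0ᵛ
          old≈0 = independent (old a) (≋-trans (≋-sym (old-combination a)) eq)
          a₀≈0 : a zero ≈ 0#
          -- The entry inserted at `k` is 0, so `old a k` is `a zero * ρ k`.
          a₀≈0 with x*y≈0⇒x≈0∨y≈0 (a zero) (ρ k)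
            (trans (sym (trans (+-congˡ (reflexive (insertAt-lookup (tail a) k 0#))) (+-identityʳ _))) (old≈0 k))
          ... | inj₁ eq = eq
          ... | inj₂ ρₖ≈0 = contradiction ρₖ≈0 ρₖ≉0
        spanning′ : ∀ {v} → has v → ∃[ a ] v ≋ combination F a b′
        spanning′ {v} v∈U with a , v≋ab ← spanning v∈U = s ∷ᵛ removeAt w k , λ i → begin
            v i                                            ≈⟨ v≋ab i ⟩
            combination F a b i
              ≈⟨ combination-cong b (λ j → solve 2 (λ x y → x := y :+ (x :+ y)) refl (a j) (s * ρ j)) i ⟩
            combination F ((s *ᵛ ρ) +ᵛ w) b i              ≈⟨ combination-+ b (s *ᵛ ρ) w i ⟩
            combination F (s *ᵛ ρ) b i + combination F w b i ≈⟨ +-cong (trans (combination-* b s ρ i) (*-congˡ (sym (r≋ρb i)))) (combination-remove b k w wₖ≈0 i) ⟩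
            s * r i + combination F (removeAt w k) (removeAt b k) i ∎
          where
          -- The multiple of `ρ` that cancels the `k`-th coefficient of `a`.
          s = a k * ρ k ⁻¹
          w = a +ᵛ (s *ᵛ ρ)
          wₖ≈0 : w k ≈ 0#
          wₖ≈0 = begin
            a k + a k * ρ k ⁻¹ * ρ k    ≈⟨ +-congˡ (*-assoc _ _ _) ⟩
            a k + a k * (ρ k ⁻¹ * ρ k)  ≈⟨ +-congˡ (*-congˡ (⁻¹-inverseˡ ρₖ≉0)) ⟩
            a k + a k * 1#              ≈⟨ +-congˡ (*-identityʳ _) ⟩
            a k + a k                   ≈⟨ x+x≈0 _ ⟩
            0#                          ∎

-- Counting the zeros of a quadratic form that is semilinear in one direction.

module Zeros {c ℓ q} (F : FiniteField c ℓ q) (q-even : IsEvenPrimePower q) where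
  open Projective F q-even public
  open ≈-Reasoning setoid

  -- Each line in direction r contains exactly one zero of φ, since squaring is bijective.
  -- So the zeros of φ in U correspond to the points of the quotient of U by r.
  zeros-of-semilinear : ∀ {N s p m} (S : PointSet F N s) (U : Subspace F N p) (D : HasDimension F U (suc m)) →
    let r = HasDimension.basis D zero in
    (φ : Vector K N → K) →
    (∀ P → PointSet.has S P → φ (proj₁ P) ≈ 0#) → (∀ P → φ (proj₁ P) ≈ 0# → PointSet.has S P) →
    (∀ {u v} → u ≋ v → φ u ≈ φ v) → (∀ a v → φ (a *ᵛ v) ≈ (a * a) * φ v) →
    φ r ≉ 0# → (∀ a {v} → Subspace.has U v → φ (a *ᵛ r +ᵛ v) ≈ (a * a) * φ r + φ v) →
    HasCardinality (_∩ᴾ_ F S U) (pointCount q m)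
  zeros-of-semilinear {N} {m = m} S U D φ S⇒φ≈0 φ≈0⇒S φ-cong φ-* φr≉0 φ-+ =
    Composition.inverse (Symmetry.inverse (Bijection⇒Inverse bijection)) (points m)
    where
    open HasDimension D renaming (basis to b)
    r = b zero
    open Subspace U using () renaming (has to _∈U)
    open Setoid (_∩ᴾ_ F S U) using () renaming (Carrier to A; _≈_ to _≈ᴬ_)
    open Setoid (PG F m) using () renaming (_≈_ to _≈ᴾ_)

    complement : Vector K m → Vector K N
    complement w = combination F w (b ∘ suc)

    complement∈U : ∀ w → complement w ∈U
    complement∈U = combination-closed U (b ∘ suc) (inside ∘ suc)

    -- The coefficient t for which t r + `complement w` is a zero of `φ`, that is, t² φ(r) =
    -- φ(`complement w`); there is no sign in characteristic 2.
    root : Vector K m → K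
    root w = proj₁ (squareRoot (φ (complement w) * φ r ⁻¹))

    root-property : ∀ w → (root w * root w) * φ r ≈ φ (complement w)
    root-property w = begin
      (root w * root w) * φ r             ≈⟨ *-congʳ (proj₂ (squareRoot (φ (complement w) * φ r ⁻¹))) ⟩
      φ (complement w) * φ r ⁻¹ * φ r     ≈⟨ *-assoc _ _ _ ⟩
      φ (complement w) * (φ r ⁻¹ * φ r)   ≈⟨ *-congˡ (⁻¹-inverseˡ φr≉0) ⟩
      φ (complement w) * 1#               ≈⟨ *-identityʳ _ ⟩
      φ (complement w)                    ∎

    root-unique : ∀ {w s} → (s * s) * φ r ≈ φ (complement w) → s ≈ root w
    root-unique {w} eq = x*x≈y*y⇒x≈y (*-cancelʳ φr≉0 (trans eq (sym (root-property w))))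

    lift : Vector K m → Vector K (suc m)
    lift w = root w ∷ᵛ w

    zeroOn : Vector K m → Vector K N
    zeroOn w = combination F (lift w) b

    φ-zeroOn : ∀ w → φ (zeroOn w) ≈ 0#
    φ-zeroOn w = begin
      φ (zeroOn w)                                   ≈⟨ φ-+ (root w) (complement∈U w) ⟩
      (root w * root w) * φ r + φ (complement w)     ≈⟨ +-congʳ (root-property w) ⟩
      φ (complement w) + φ (complement w)            ≈⟨ x+x≈0 _ ⟩
      0#                                             ∎

    to : Point F m → A
    to (w , w≉0) = P , φ≈0⇒S P (φ-zeroOn w) , combination-closed U b inside (lift w)
      where
      P : Point F N
      P = zeroOn w , λ eq → w≉0 (independent (lift w) eq ∘ suc)

    -- Square roots are unique, so scaling `w` by `a` scales its root by `a`. Hence the lifted zero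
    -- depends only on the projective point.
    lift-* : ∀ {a u v} → u ≋ a *ᵛ v → lift u ≋ a *ᵛ lift v
    lift-* {a} {u} {v} eq zero = sym (root-unique (begin
      ((a * root v) * (a * root v)) * φ r
        ≈⟨ solve 3 (λ a s x → ((a :* s) :* (a :* s)) :* x := (a :* a) :* ((s :* s) :* x)) refl a (root v) (φ r) ⟩
      (a * a) * ((root v * root v) * φ r)   ≈⟨ *-congˡ (root-property v) ⟩
      (a * a) * φ (complement v)            ≈⟨ φ-* a _ ⟨
      φ (a *ᵛ complement v)
        ≈⟨ φ-cong (≋-trans (combination-cong (b ∘ suc) eq) (combination-* (b ∘ suc) a v)) ⟨
      φ (complement u)                      ∎))
    lift-* eq (suc i) = eq i

    to-cong : ∀ {P Q} → P ≈ᴾ Q → to P ≈ᴬ to Q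
    to-cong {u , _} {v , _} (a , a≉0 , eq) = a , a≉0 , ≋-trans (combination-cong b (lift-* {a} {u} {v} eq)) (combination-* b a (lift v))

    injective : ∀ {P Q} → to P ≈ᴬ to Q → P ≈ᴾ Q
    injective {u , _} {v , _} (a , a≉0 , eq) = a , a≉0 ,
      combination-injective b independent {lift u} {a *ᵛ lift v} (≋-trans eq (≋-sym (combination-* b a (lift v)))) ∘ suc

    surjective : ∀ x → ∃[ P ] to P ≈ᴬ x
    surjective ((v , v≉0) , v∈S , v∈U) with a , v≋ab ← spanning v∈U =
      (tail a , w≉0) , 1# , 1≉0 , λ i → begin
        zeroOn (tail a) i    ≈⟨ combination-cong b {lift (tail a)} {a} (λ { zero → sym a₀≈root ; (suc j) → refl }) i ⟩
        combination F a b i  ≈⟨ v≋ab i ⟨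
        v i                  ≈⟨ *-identityˡ (v i) ⟨
        1# * v i             ∎
      where
      -- As `v` is a zero of `φ`, its coefficient along `r` solves the equation that defines the
      -- root.
      a₀≈root : a zero ≈ root (tail a)
      a₀≈root = root-unique (x+y≈0⇒x≈y (begin
        (a zero * a zero) * φ r + φ (complement (tail a)) ≈⟨ φ-+ (a zero) (complement∈U (tail a)) ⟨
        φ (combination F a b)                             ≈⟨ φ-cong v≋ab ⟨
        φ v                                               ≈⟨ S⇒φ≈0 (v , v≉0) v∈S ⟩
        0#                                                ∎))
      root-0 : ∀ {w} → w ≋ 0ᵛ → root w ≈ 0#
      -- Here `w` is 0 times itself, so homogeneity makes its root 0 times itself.
      root-0 {w} w≈0 = trans (lift-* {0#} {w} {w} (λ i → trans (w≈0 i) (sym (zeroˡ (w i)))) zero) (zeroˡ _)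
      w≉0 : ¬ tail a ≋ 0ᵛ
      w≉0 w≈0 = v≉0 (≋-trans v≋ab (≋-trans
        (combination-cong b {a} {0ᵛ} (λ { zero → trans a₀≈root (root-0 w≈0) ; (suc j) → w≈0 j })) (combination-0 b)))

    bijection : Bijection (PG F m) (_∩ᴾ_ F S U)
    bijection = record
      { to        = to
      ; cong      = λ {P} {Q} → to-cong {P} {Q}
      ; bijective = (λ {P} {Q} → injective {P} {Q}) ,
          strictlySurjective⇒surjective (PG F m) (_∩ᴾ_ F S U) {to} (λ {P} {Q} → to-cong {P} {Q}) surjective
      }

-- Indices of the coordinates and sums over them.

module Coordinates {c ℓ q} (F : FiniteField c ℓ q) (n : ℕ) where

  open FiniteField F
    using (_≈_; _+_; semiring; sym; trans; reflexive; +-congʳ; +-congˡ; +-assoc; +-identityˡ)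
    renaming (Carrier to K)
  open Algebra.Properties.Semiring.Sum semiring using (sum; sum-cong-≋; sum-permute; sum-init-last)

  -- `l j` stands for X_(j+2) and `o j` for its hyperbolic partner X_(2n+1-j). Thus `o zero` and
  -- `o (suc zero)` belong to X_(2n+1) and X_(2n).
  l o : Fin n → Fin (dim n)
  l = lower F n
  o = opposite ∘ l

  private
    n+0≡n : n ℕ.+ 0 ≡ n
    n+0≡n = ℕ.+-identityʳ n

  -- The partners fill the second half of the middle block in reverse order. The `cast` appears
  -- because 2 * n unfolds to n + (n + 0).
  opposite-lower : ∀ j → o j ≡ suc (inject₁ (n ↑ʳ cast (≡.sym n+0≡n) (opposite j)))
  opposite-lower j = toℕ-injective (begin
    toℕ (o j)                                     ≡⟨ opposite-prop (l j) ⟩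
    n ℕ.+ (n ℕ.+ 0) ℕ.∸ toℕ (inject₁ (j ↑ˡ (n ℕ.+ 0)))
      ≡⟨ ≡.cong₂ (λ a b → n ℕ.+ a ∸ b) n+0≡n (≡.trans (toℕ-inject₁ _) (toℕ-↑ˡ j _)) ⟩
    (n ℕ.+ n) ∸ toℕ j                             ≡⟨ ℕ.+-∸-assoc n (ℕ.<⇒≤ (toℕ<n j)) ⟩
    n ℕ.+ (n ∸ toℕ j)                             ≡⟨ ≡.cong (n ℕ.+_) (ℕ.+-∸-assoc 1 (toℕ<n j)) ⟩
    n ℕ.+ suc (n ∸ suc (toℕ j))                   ≡⟨ ℕ.+-suc n _ ⟩
    suc (n ℕ.+ (n ∸ suc (toℕ j)))                 ≡⟨ ≡.cong (λ a → suc (n ℕ.+ a)) (≡.trans (toℕ-cast _ (opposite j)) (opposite-prop j)) ⟨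
    suc (n ℕ.+ toℕ (cast (≡.sym n+0≡n) (opposite j))) ≡⟨ ≡.cong suc (≡.trans (toℕ-inject₁ _) (toℕ-↑ʳ n _)) ⟨
    toℕ (suc (inject₁ (n ↑ʳ cast (≡.sym n+0≡n) (opposite j)))) ∎)
    where open ≡.≡-Reasoning

  -- Serves to conclude that a vector is zero from the functionals that occur in the elliptic form.
  coordinate-cases : ∀ {p} (P : Fin (dim n) → Set p) → P (i₁ F n) → P (i₂ₙ₊₂ F n) → (∀ j → P (l j)) → (∀ j → P (o j)) → ∀ i → P i
  coordinate-cases P P₀ P₁ Pl Po zero = P₀
  coordinate-cases P P₀ P₁ Pl Po (suc i) with view i
  ... | ‵fromℕ = P₁
  ... | ‵inject₁ k = ≡.subst (P ∘ suc ∘ inject₁) (join-splitAt n (n ℕ.+ 0) k) (middle (splitAt n k))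
    where
    middle : ∀ s → P (suc (inject₁ (join n (n ℕ.+ 0) s)))
    middle (inj₁ j) = Pl j
    middle (inj₂ j) = ≡.subst P (≡.trans (opposite-lower (opposite (cast n+0≡n j)))
      (≡.cong (λ k → suc (inject₁ (n ↑ʳ k)))
        (≡.trans (≡.cong (cast (≡.sym n+0≡n)) (opposite-involutive (cast n+0≡n j)))
                 (cast-involutive (≡.sym n+0≡n) n+0≡n j))))
      (Po (opposite (cast n+0≡n j)))

  sum-+ : ∀ a {b} (f : Vector K (a ℕ.+ b)) → sum f ≈ sum (λ j → f (j ↑ˡ b)) + sum (λ j → f (a ↑ʳ j))
  sum-+ zero    f = sym (+-identityˡ _)
  sum-+ (suc a) f = trans (+-congˡ (sum-+ a (f ∘ suc))) (sym (+-assoc _ _ _))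

  -- The lengths are variables so that their equation can be matched with `refl`; the instance used
  -- relates n and n + 0.
  sum-reverse : ∀ {a b} (a≡b : a ≡ b) (f : Vector K b) → sum f ≈ sum (λ j → f (cast a≡b (opposite j)))
  sum-reverse ≡.refl f = trans (sum-permute f reverse)
    (sum-cong-≋ {_} {f ∘ opposite} (λ j → reflexive (≡.cong f (≡.sym (cast-is-id ≡.refl (opposite j))))))

  sum-coordinates : ∀ (f : Vector K (dim n)) → sum f ≈ f (i₁ F n) + (sum (f ∘ l) + sum (f ∘ o) + f (i₂ₙ₊₂ F n))
  sum-coordinates f = +-congˡ (trans (sum-init-last (f ∘ suc)) (+-congʳ (trans (sum-+ n (f ∘ suc ∘ inject₁)) (+-congˡ
    (trans (sum-reverse (≡.sym n+0≡n) (λ k → f (suc (inject₁ (n ↑ʳ k)))))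
      (sum-cong-≋ (λ j → reflexive (≡.cong f (≡.sym (opposite-lower j))))))))))

-- The quadric: polarization and hyperbolic shape.

module Quadric {c ℓ q} (F : FiniteField c ℓ q) (q-even : IsEvenPrimePower q) (m : ℕ)
  {δ} (irreducible : IsIrreducibleX²+X+ F δ) (μ : FiniteField.Carrier F) where

  open Zeros F q-even
  private
    n : ℕ
    -- In this form `o zero` and `o (suc zero)` reduce to the indices of X_(2n+1) and X_(2n).
    n = suc (suc m)
  open Coordinates F n
  open Algebra.Properties.Semiring.Sum semiring using (sum; sum-cong-≋; ∑-distrib-+; sum-replicate-zero)
  open ≈-Reasoning setoid

  private
    V = Vector K (dim n)
    N = ellipticForm F δ
    B = B₀ F n
    Q = quadraticForm F n δ μ
    e₁ = i₁ F n
    e₂ₙ₊₂ = i₂ₙ₊₂ F n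
    f g : Fin (dim n)
    f = i₂ₙ F n
    g = i₂ₙ₊₁ F n

  β : V → V → K
  β u v = u f * v g + u g * v f

  ellipticForm-polar : ∀ x y x′ y′ → N (x + x′) (y + y′) ≈ N x y + N x′ y′ + (x * y′ + y * x′)
  ellipticForm-polar x y x′ y′ = solve 5 (λ δ x y x′ y′ →
    (x :+ x′) :* (x :+ x′) :+ (x :+ x′) :* (y :+ y′) :+ δ :* ((y :+ y′) :* (y :+ y′)) :=
    (x :* x :+ x :* y :+ δ :* (y :* y)) :+ (x′ :* x′ :+ x′ :* y′ :+ δ :* (y′ :* y′)) :+ (x :* y′ :+ y :* x′)) refl δ x y x′ y′

  B₀-coordinates : ∀ u v → B u v ≈ u e₁ * v e₂ₙ₊₂ + (sum (λ j → u (l j) * v (o j)) + sum (λ j → u (o j) * v (l j)) + u e₂ₙ₊₂ * v e₁)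
  B₀-coordinates u v = trans (sum-coordinates (λ i → u i * v (opposite i)))
    (+-congˡ (+-cong (+-congˡ (sum-cong-≋ {n} {λ j → u (o j) * v (opposite (o j))} {λ j → u (o j) * v (l j)}
        (λ j → *-congˡ (reflexive (≡.cong v (opposite-involutive (l j)))))))
      (*-congˡ (reflexive (≡.cong v (opposite-involutive e₁))))))

  B₀-congʳ : ∀ {u v} → u ≋ v → ∀ w → B u w ≈ B v w
  B₀-congʳ {u} {v} u≋v w = sum-cong-≋ {dim n} {λ i → u i * w (opposite i)} {λ i → v i * w (opposite i)} (λ i → *-congʳ (u≋v i))

  -- The cross terms of the first two summands assemble into B₀ by `B₀-coordinates`; those of the
  -- last one give μ β.
  quadraticForm-polar : ∀ u v → Q (u +ᵛ v) ≈ Q u + Q v + (B u v + μ * β u v)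
  quadraticForm-polar u v = begin
    Q (u +ᵛ v)
      ≈⟨ +-cong (+-cong (ellipticForm-polar (u e₁) (u e₂ₙ₊₂) (v e₁) (v e₂ₙ₊₂)) products) (*-congˡ (ellipticForm-polar (u f) (u g) (v f) (v g))) ⟩
    (Nu + Nv + (p + p′)) + (Su + Sv + (s + s′)) + μ * (Mu + Mv + β u v)
      ≈⟨ solve 12 (λ Nu Nv p p′ Su Sv s s′ μ Mu Mv b →
           (Nu :+ Nv :+ (p :+ p′)) :+ (Su :+ Sv :+ (s :+ s′)) :+ μ :* (Mu :+ Mv :+ b) :=
           (Nu :+ Su :+ μ :* Mu) :+ (Nv :+ Sv :+ μ :* Mv) :+ ((p :+ (s :+ s′ :+ p′)) :+ μ :* b)) refl Nu Nv p p′ Su Sv s s′ μ Mu Mv (β u v) ⟩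
    Q u + Q v + ((p + (s + s′ + p′)) + μ * β u v)
      ≈⟨ +-congˡ (+-congʳ (B₀-coordinates u v)) ⟨
    Q u + Q v + (B u v + μ * β u v) ∎
    where
    Nu = N (u e₁) (u e₂ₙ₊₂)
    Nv = N (v e₁) (v e₂ₙ₊₂)
    p = u e₁ * v e₂ₙ₊₂
    p′ = u e₂ₙ₊₂ * v e₁
    Su = sum (λ j → u (l j) * u (o j))
    Sv = sum (λ j → v (l j) * v (o j))
    s = sum (λ j → u (l j) * v (o j))
    s′ = sum (λ j → u (o j) * v (l j))
    Mu = N (u f) (u g)
    Mv = N (v f) (v g)
    products : sum (λ j → (u (l j) + v (l j)) * (u (o j) + v (o j))) ≈ Su + Sv + (s + s′)
    products = begin
      sum (λ j → (u (l j) + v (l j)) * (u (o j) + v (o j)))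
        ≈⟨ sum-cong-≋ (λ j → solve 4 (λ a b c d → (a :+ b) :* (c :+ d) := (a :* c :+ b :* d) :+ (a :* d :+ c :* b)) refl (u (l j)) (v (l j)) (u (o j)) (v (o j))) ⟩
      sum (λ j → (u (l j) * u (o j) + v (l j) * v (o j)) + (u (l j) * v (o j) + u (o j) * v (l j)))
        ≈⟨ ∑-distrib-+ (λ j → u (l j) * u (o j) + v (l j) * v (o j)) (λ j → u (l j) * v (o j) + u (o j) * v (l j)) ⟩
      sum (λ j → u (l j) * u (o j) + v (l j) * v (o j)) + sum (λ j → u (l j) * v (o j) + u (o j) * v (l j))
        ≈⟨ +-cong (∑-distrib-+ (λ j → u (l j) * u (o j)) (λ j → v (l j) * v (o j))) (∑-distrib-+ (λ j → u (l j) * v (o j)) (λ j → u (o j) * v (l j))) ⟩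
      Su + Sv + (s + s′) ∎

  -- The lower coordinates after a linear change of variables that carries 𝒬_μ to 𝒬₀.
  T : Fin n → V → K
  T zero          v = v (l zero) + (μ * δ) * v g
  T (suc zero)    v = v (l (suc zero)) + μ * (v f + v g)
  T (suc (suc j)) v = v (l (suc (suc j)))

  -- The term μ δ X_(2n+1)² is absorbed into the pair of X_(2n+1), and the terms μ X_(2n)² and μ
  -- X_(2n) X_(2n+1) into the pair of X_(2n).
  quadraticForm-hyperbolic : ∀ v → Q v ≈ N (v e₁) (v e₂ₙ₊₂) + sum (λ j → T j v * v (o j))
  quadraticForm-hyperbolic v =
    solve 8 (λ N l₀ l₁ f g δ μ s →
      N :+ (l₀ :* g :+ (l₁ :* f :+ s)) :+ μ :* (f :* f :+ f :* g :+ δ :* (g :* g)) :=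
      N :+ ((l₀ :+ (μ :* δ) :* g) :* g :+ ((l₁ :+ μ :* (f :+ g)) :* f :+ s)))
      refl (N (v e₁) (v e₂ₙ₊₂)) (v (l zero)) (v (l (suc zero))) (v f) (v g) δ μ _

  T-cong : ∀ j {u v} → u ≋ v → T j u ≈ T j v
  T-cong zero          eq = +-cong (eq _) (*-congˡ (eq g))
  T-cong (suc zero)    eq = +-cong (eq _) (*-congˡ (+-cong (eq f) (eq g)))
  T-cong (suc (suc j)) eq = eq _

  T-+ : ∀ j u v → T j (u +ᵛ v) ≈ T j u + T j v
  T-+ zero          u v = solve 5 (λ a b c d x → (a :+ b) :+ x :* (c :+ d) := (a :+ x :* c) :+ (b :+ x :* d)) refl
    (u (l zero)) (v (l zero)) (u g) (v g) (μ * δ)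
  T-+ (suc zero)    u v = solve 7 (λ a b c d e h x →
    (a :+ b) :+ x :* ((c :+ d) :+ (e :+ h)) := (a :+ x :* (c :+ e)) :+ (b :+ x :* (d :+ h))) refl
    (u (l (suc zero))) (v (l (suc zero))) (u f) (v f) (u g) (v g) μ
  T-+ (suc (suc j)) u v = refl

  module _ {N d} (b : Vector (Vector K N) d) where

    -- Functionals of vectors become functionals of coefficients with respect to `b`, the form in
    -- which `common-zero` takes them.
    pullback : (h : Vector K N → K) → (∀ {u v} → u ≋ v → h u ≈ h v) → (∀ u v → h (u +ᵛ v) ≈ h u + h v) → Additive d
    pullback h h-cong h-+ = record
      { ⟦_⟧    = λ a → h (combination F a b)
      ; +-homo = λ u v → trans (h-cong (combination-+ b u v)) (h-+ _ _)
      }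

    coordinate : Fin N → Additive d
    coordinate i = pullback (λ v → v i) (λ eq → eq i) (λ _ _ → refl)

  -- After the change of variables `T` the form has n hyperbolic pairs, so `common-zero` without
  -- constraints yields a non-zero coefficient vector at which every coordinate vanishes, against
  -- independence.
  ¬totallySingular : ∀ {d} (b : Vector V d) → n < d → (∀ a → combination F a b ≋ 0ᵛ → a ≋ 0ᵛ) →
    ¬ (∀ a → Q (combination F a b) ≈ 0#)
  ¬totallySingular {d} b n<d independent singular =
    let a , a≉0 , _ , x≈0 , y≈0 , T≈0 , o≈0 = common-zero irreducible n {0} {d}
          (≡.subst (_< d) (≡.sym (ℕ.+-identityʳ n)) n<d) (λ ())
          (coordinate b e₁) (coordinate b e₂ₙ₊₂) (λ j → pullback b (T j) (T-cong j) (T-+ j)) (λ j → coordinate b (o j))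
          (λ a _ → trans (sym (quadraticForm-hyperbolic (combination F a b))) (singular a))
    in a≉0 (independent a (coordinate-cases (λ i → combination F a b i ≈ 0#) x≈0 y≈0
         (λ j → l≈0 (combination F a b) j T≈0 o≈0) o≈0))
    where
    l≈0 : ∀ v j → (∀ j → T j v ≈ 0#) → (∀ j → v (o j) ≈ 0#) → v (l j) ≈ 0#
    l≈0 v zero T≈0 o≈0 = begin
      v (l zero)                       ≈⟨ solve 2 (λ a x → a := a :+ x :* con false) refl (v (l zero)) (μ * δ) ⟩
      v (l zero) + (μ * δ) * 0#        ≈⟨ +-congˡ (*-congˡ (o≈0 zero)) ⟨
      T zero v                         ≈⟨ T≈0 zero ⟩
      0#                               ∎
    l≈0 v (suc zero) T≈0 o≈0 = begin
      v (l (suc zero))                       ≈⟨ solve 2 (λ a x → a := a :+ x :* (con false :+ con false)) refl (v (l (suc zero))) μ ⟩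
      v (l (suc zero)) + μ * (0# + 0#)       ≈⟨ +-congˡ (*-congˡ (+-cong (o≈0 (suc zero)) (o≈0 zero))) ⟨
      T (suc zero) v                         ≈⟨ T≈0 (suc zero) ⟩
      0#                                     ∎
    l≈0 v (suc (suc j)) T≈0 o≈0 = T≈0 (suc (suc j))

  -- Generators: a regular direction and the count of points.

  module _ {p} (G : Generator F n p) where
    open Generator G
    open Subspace subspace using () renaming (has to _∈G)
    open HasDimension rank renaming (basis to b)

    -- The polar form of 𝒬_μ restricts to μ β on G, so such an r makes the restriction of Q to G additive in direction r.
    Regular : V → Set _
    Regular r = r ∈G × Q r ≉ 0# × (∀ {v} → v ∈G → β v r ≈ 0#)

    module _ (radical-singular : ∀ a → combination F a b f ≈ 0# → combination F a b g ≈ 0# →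
                Q (combination F a b) ≈ 0#) where

      private
        -- Under B₀ these unit vectors read off the coordinates X_(2n+1) and X_(2n).
        e₂ e₃ : V
        e₂ = 0# ∷ᵛ 1# ∷ᵛ 0ᵛ
        e₃ = 0# ∷ᵛ 0# ∷ᵛ 1# ∷ᵛ 0ᵛ

        -- Not assumed independent: a linear relation among these n + 3 vectors is what `dependent`
        -- extracts.
        b⁺ : Vector V (suc (suc (suc n)))
        b⁺ = e₂ ∷ᵛ e₃ ∷ᵛ b

        w w′ : Vector K (suc (suc (suc n))) → V
        w a = combination F a b⁺
        w′ a = combination F (tail (tail a)) b

        -- Rewritten by `opposite-lower`, the index visibly lies beyond the first three, where the
        -- entry computes to 0.
        e₂-upper : ∀ j → e₂ (o j) ≈ 0#
        e₂-upper j = reflexive (≡.cong e₂ (opposite-lower j))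

        e₃-upper : ∀ j → e₃ (o j) ≈ 0#
        e₃-upper j = reflexive (≡.cong e₃ (opposite-lower j))

        unchanged : ∀ a i → e₂ i ≈ 0# → e₃ i ≈ 0# → w a i ≈ w′ a i
        unchanged a i e₂≈0 e₃≈0 = trans (+-cong (*-congˡ e₂≈0) (+-congʳ (*-congˡ e₃≈0)))
          (solve 3 (λ s t x → s :* con false :+ (t :* con false :+ x) := x) refl (a zero) (a (suc zero)) (w′ a i))

        -- Adding `e₂` and `e₃` changes only X_2 and X_3, whose partners are zero here, so Q₀ takes
        -- the same value at `w a` and `w′ a`. At `w′ a` the μ-term is zero, so Q₀ agrees with Q_μ.
        singular⁺ : ∀ a → w a f ≈ 0# → w a g ≈ 0# →
          N (w a e₁) (w a e₂ₙ₊₂) + sum (λ j → w a (l j) * w a (o j)) ≈ 0#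
        singular⁺ a wf≈0 wg≈0 = begin
          N (w a e₁) (w a e₂ₙ₊₂) + sum (λ j → w a (l j) * w a (o j))
            ≈⟨ +-cong (ellipticForm-cong F δ (unchanged a e₁ refl refl) (unchanged a e₂ₙ₊₂ refl refl)) (sum-cong-≋ product) ⟩
          N (w′ a e₁) (w′ a e₂ₙ₊₂) + sum (λ j → w′ a (l j) * w′ a (o j))
            ≈⟨ solve 3 (λ x δ μ → x := x :+ μ :* (con false :* con false :+ con false :* con false :+ δ :* (con false :* con false))) refl _ δ μ ⟩
          N (w′ a e₁) (w′ a e₂ₙ₊₂) + sum (λ j → w′ a (l j) * w′ a (o j)) + μ * N 0# 0#
            ≈⟨ +-congˡ (*-congˡ (ellipticForm-cong F δ w′f≈0 w′g≈0)) ⟨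
          Q (w′ a)
            ≈⟨ radical-singular (tail (tail a)) w′f≈0 w′g≈0 ⟩
          0# ∎
          where
          upper : ∀ j → w a (o j) ≈ w′ a (o j)
          upper j = unchanged a (o j) (e₂-upper j) (e₃-upper j)
          w′f≈0 : w′ a f ≈ 0#
          w′f≈0 = trans (sym (upper (suc zero))) wf≈0
          w′g≈0 : w′ a g ≈ 0#
          w′g≈0 = trans (sym (upper zero)) wg≈0
          product : ∀ j → w a (l j) * w a (o j) ≈ w′ a (l j) * w′ a (o j)
          product zero = trans (*-congˡ wg≈0) (trans (zeroʳ _) (sym (trans (*-congˡ w′g≈0) (zeroʳ _))))
          product (suc zero) = trans (*-congˡ wf≈0) (trans (zeroʳ _) (sym (trans (*-congˡ w′f≈0) (zeroʳ _))))
          product (suc (suc j)) = *-cong (unchanged a (l (suc (suc j))) refl refl) (upper (suc (suc j)))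

        B₀-e₂-e₃ : ∀ s t u → B ((s *ᵛ e₂) +ᵛ (t *ᵛ e₃)) u ≈ s * u g + t * u f
        B₀-e₂-e₃ s t u = trans
          (+-congˡ (+-congˡ (+-congˡ (trans
            (sum-cong-≋ {_} {λ i → (s * 0# + t * 0#) * rest i} {λ _ → 0#}
              (λ i → solve 3 (λ s t x → (s :* con false :+ t :* con false) :* x := con false) refl s t (rest i)))
            (sum-replicate-zero (suc (m ℕ.+ (n ℕ.+ 0))))))))
          (solve 5 (λ s t x y z →
            (s :* con false :+ t :* con false) :* x :+
              ((s :* con true :+ t :* con false) :* y :+ ((s :* con false :+ t :* con true) :* z :+ con false))
            := s :* y :+ t :* z) refl s t (u (opposite zero)) (u g) (u f))
          where
          rest : Vector K (suc (m ℕ.+ (n ℕ.+ 0)))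
          rest i = u (opposite (suc (suc (suc i))))

      -- If R = G ∩ {X_{2n} = X_{2n+1} = 0} is totally singular then so is R + ⟨e₂, e₃⟩ for 𝒬₀, which is too large
      -- unless some s e₂ + t e₃ ≠ 0 lies in G; isotropy then makes X_{2n} and X_{2n+1} dependent on G.
      dependent : ∃[ s ] ∃[ t ] (s ≉ 0# ⊎ t ≉ 0#) × (∀ {u} → u ∈G → s * u g + t * u f ≈ 0#)
      -- The n pairs and the two constraints X_(2n) = X_(2n+1) = 0 number n + 2, one less than the
      -- coefficients.
      dependent = conclude (common-zero irreducible n {2} {suc (suc (suc n))} (s≤s (ℕ.≤-reflexive (ℕ.+-comm n 2)))
          L⁺ (coordinate b⁺ e₁) (coordinate b⁺ e₂ₙ₊₂) (λ j → coordinate b⁺ (l j)) (λ j → coordinate b⁺ (o j))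
          (λ a La≈0 → singular⁺ a (La≈0 zero) (La≈0 (suc zero))))
        where
        L⁺ : Vector (Additive (suc (suc (suc n)))) 2
        L⁺ = coordinate b⁺ f ∷ᵛ coordinate b⁺ g ∷ᵛ λ ()
        split : ∀ a → w a ≋ 0ᵛ → (a zero *ᵛ e₂) +ᵛ (a (suc zero) *ᵛ e₃) ≋ w′ a
        split a wa≈0 i = x+y≈0⇒x≈y (trans (+-assoc (a zero * e₂ i) (a (suc zero) * e₃ i) (w′ a i)) (wa≈0 i))
        relation : ∀ a → w a ≋ 0ᵛ → ∀ {u} → u ∈G → a zero * u g + a (suc zero) * u f ≈ 0#
        relation a wa≈0 {u} u∈G = begin
          a zero * u g + a (suc zero) * u f               ≈⟨ B₀-e₂-e₃ (a zero) (a (suc zero)) u ⟨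
          B ((a zero *ᵛ e₂) +ᵛ (a (suc zero) *ᵛ e₃)) u    ≈⟨ B₀-congʳ {(a zero *ᵛ e₂) +ᵛ (a (suc zero) *ᵛ e₃)} {w′ a} (split a wa≈0) u ⟩
          B (w′ a) u                                      ≈⟨ isotropic (combination-closed subspace b inside (tail (tail a))) u∈G ⟩
          0#                                              ∎
        -- If both leading coefficients were 0, the relation would be one among the basis `b` alone.
        nonzero : ∀ a → w a ≋ 0ᵛ → ¬ a ≋ 0ᵛ → ¬ (a zero ≈ 0# × a (suc zero) ≈ 0#)
        nonzero a wa≈0 a≉0 (s≈0 , t≈0) = a≉0 (λ
          { zero → s≈0 ; (suc zero) → t≈0 ; (suc (suc j)) → independent (tail (tail a)) w′≈0 j })
          where
          w′≈0 : w′ a ≋ 0ᵛ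
          w′≈0 i = begin
            w′ a i                           ≈⟨ solve 3 (λ x y z → z := con false :* x :+ (con false :* y :+ z)) refl (e₂ i) (e₃ i) (w′ a i) ⟩
            0# * e₂ i + (0# * e₃ i + w′ a i) ≈⟨ +-cong (*-congʳ s≈0) (+-congʳ (*-congʳ t≈0)) ⟨
            w a i                            ≈⟨ wa≈0 i ⟩
            0#                               ∎
        conclude : CommonZero irreducible L⁺ (coordinate b⁺ e₁) (coordinate b⁺ e₂ₙ₊₂)
            (λ j → coordinate b⁺ (l j)) (λ j → coordinate b⁺ (o j)) →
          ∃[ s ] ∃[ t ] (s ≉ 0# ⊎ t ≉ 0#) × (∀ {u} → u ∈G → s * u g + t * u f ≈ 0#)
        conclude (a , a≉0 , _ , x≈0 , y≈0 , l≈0 , o≈0) =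
          a zero , a (suc zero) , nonzero⇒≉0∨≉0 (nonzero a wa≈0 a≉0) , relation a wa≈0
          where
          wa≈0 : w a ≋ 0ᵛ
          wa≈0 = coordinate-cases (λ i → w a i ≈ 0#) x≈0 y≈0 l≈0 o≈0

      -- In characteristic 2, `β` is the 2 by 2 determinant of the coordinates X_(2n) and X_(2n+1),
      -- which are linearly dependent on `G`.
      β-vanishes : ∀ {u v} → u ∈G → v ∈G → β u v ≈ 0#
      β-vanishes {u} {v} u∈G v∈G = let s , t , nonzero , relation = dependent in cancel s t nonzero (relation u∈G) (relation v∈G)
        where
        cancel : ∀ s t → s ≉ 0# ⊎ t ≉ 0# → s * u g + t * u f ≈ 0# → s * v g + t * v f ≈ 0# → β u v ≈ 0#
        cancel s t (inj₁ s≉0) u-relation v-relation = x*y≈0∧x≉0⇒y≈0 (begin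
          s * (u f * v g + u g * v f)
            ≈⟨ solve 6 (λ s t uf ug vf vg →
                 s :* (uf :* vg :+ ug :* vf) := uf :* (s :* vg :+ t :* vf) :+ (s :* ug :+ t :* uf) :* vf)
                 refl s t (u f) (u g) (v f) (v g) ⟩
          u f * (s * v g + t * v f) + (s * u g + t * u f) * v f ≈⟨ +-cong (*-congˡ v-relation) (*-congʳ u-relation) ⟩
          u f * 0# + 0# * v f  ≈⟨ +-cong (zeroʳ _) (zeroˡ _) ⟩
          0# + 0#              ≈⟨ +-identityˡ 0# ⟩
          0#                   ∎) s≉0
        cancel s t (inj₂ t≉0) u-relation v-relation = x*y≈0∧x≉0⇒y≈0 (begin
          t * (u f * v g + u g * v f)
            ≈⟨ solve 6 (λ s t uf ug vf vg →
                 t :* (uf :* vg :+ ug :* vf) := ug :* (s :* vg :+ t :* vf) :+ (s :* ug :+ t :* uf) :* vg)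
                 refl s t (u f) (u g) (v f) (v g) ⟩
          u g * (s * v g + t * v f) + (s * u g + t * u f) * v g ≈⟨ +-cong (*-congˡ v-relation) (*-congʳ u-relation) ⟩
          u g * 0# + 0# * v g  ≈⟨ +-cong (zeroʳ _) (zeroˡ _) ⟩
          0# + 0#              ≈⟨ +-identityˡ 0# ⟩
          0#                   ∎) t≉0

    -- The case distinction is made by exhaustive search over the finitely many coefficient vectors,
    -- first within R and then in all of `G`.
    regular : ∃[ r ] Regular r
    regular = radical-or-all
      (any? (λ i → (value i f ≟ 0#) ×-dec (value i g ≟ 0#) ×-dec ¬? (Q (value i) ≟ 0#)))
      (any? (λ i → ¬? (Q (value i) ≟ 0#)))
      where
      value : Fin (q ^ suc n) → V
      value i = combination F (decode {suc n} i) b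
      value∈G : ∀ i → value i ∈G
      value∈G i = combination-closed subspace b inside (decode {suc n} i)
      value-encode : ∀ a → value (encode a) ≋ combination F a b
      value-encode a = combination-cong b (decode-encode a)
      Q-encode : ∀ a → Q (value (encode a)) ≈ Q (combination F a b)
      Q-encode a = quadraticForm-cong F n δ μ (value-encode a)
      radical-or-all : Dec (∃[ i ] value i f ≈ 0# × value i g ≈ 0# × Q (value i) ≉ 0#) →
        Dec (∃[ i ] Q (value i) ≉ 0#) → ∃[ r ] Regular r
      radical-or-all (yes (i , rf≈0 , rg≈0 , Qr≉0)) _ = value i , value∈G i , Qr≉0 ,
        λ _ → trans (+-cong (trans (*-congˡ rg≈0) (zeroʳ _)) (trans (*-congˡ rf≈0) (zeroʳ _))) (+-identityˡ 0#)
      -- The failed search shows that `Q` vanishes on R, which is the hypothesis of `β-vanishes`.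
      radical-or-all (no none) (yes (i , Qr≉0)) = value i , value∈G i , Qr≉0 ,
        λ v∈G → β-vanishes (λ a vf≈0 vg≈0 → decidable-stable (Q (combination F a b) ≟ 0#) (λ Qv≉0 → none (encode a ,
          trans (value-encode a f) vf≈0 , trans (value-encode a g) vg≈0 , λ Q≈0 → Qv≉0 (trans (sym (Q-encode a)) Q≈0)))) v∈G (value∈G i)
      -- Otherwise all of `G`, of vector dimension n + 1, would be totally singular.
      radical-or-all (no _) (no none) = contradiction
        (λ a → decidable-stable (Q (combination F a b) ≟ 0#) (λ Qv≉0 → none (encode a , λ Q≈0 → Qv≉0 (trans (sym (Q-encode a)) Q≈0))))
        (¬totallySingular b (ℕ.n<1+n n) independent)

    quadric∩G : HasCardinality (_∩ᴾ_ F (quadric F n δ μ) subspace) (pointCount q n)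
    quadric∩G = throughRegular regular
      where
      throughRegular : ∃[ r ] Regular r → _
      throughRegular (r , r∈G , Qr≉0 , βr≈0) = count (extendToBasis subspace rank r∈G r≉0)
        where
        r≉0 : ¬ r ≋ 0ᵛ
        r≉0 r≈0 = Qr≉0 (begin
          Q r               ≈⟨ quadraticForm-cong F n δ μ (λ i → trans (r≈0 i) (sym (zeroˡ (r i)))) ⟩
          Q (0# *ᵛ r)       ≈⟨ quadraticForm-scale F n δ μ 0# r ⟩
          (0# * 0#) * Q r   ≈⟨ trans (*-congʳ (zeroˡ 0#)) (zeroˡ _) ⟩
          0#                ∎)
        Q-+ : ∀ a {v} → v ∈G → Q (a *ᵛ r +ᵛ v) ≈ (a * a) * Q r + Q v
        Q-+ a {v} v∈G = begin
          Q (a *ᵛ r +ᵛ v)                      ≈⟨ quadraticForm-polar (a *ᵛ r) v ⟩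
          Q (a *ᵛ r) + Q v + (B (a *ᵛ r) v + μ * β (a *ᵛ r) v)
            ≈⟨ +-cong (+-congʳ (quadraticForm-scale F n δ μ a r))
                 -- On `G` the form B₀ vanishes, which leaves only μ β, and `r` is in the radical of
                 -- β.
                 (+-cong (isotropic (Subspace.*-closed subspace a r∈G) v∈G)
                   (*-congˡ (solve 5 (λ a rf rg vf vg →
                     (a :* rf) :* vg :+ (a :* rg) :* vf := a :* (vf :* rg :+ vg :* rf)) refl a (r f) (r g) (v f) (v g)))) ⟩
          (a * a) * Q r + Q v + (0# + μ * (a * β v r)) ≈⟨ +-congˡ (+-congˡ (*-congˡ (*-congˡ (βr≈0 v∈G)))) ⟩
          (a * a) * Q r + Q v + (0# + μ * (a * 0#))
            ≈⟨ solve 3 (λ x μ a → x :+ (con false :+ μ :* (a :* con false)) := x) refl _ μ a ⟩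
          (a * a) * Q r + Q v ∎
        count : Σ[ D ∈ HasDimension F subspace (suc n) ] HasDimension.basis D zero ≡ r → _
        -- Matching on `refl` makes `r` the first basis vector of `D`, so the facts about `r` apply
        -- to it.
        count (D , ≡.refl) = zeros-of-semilinear (quadric F n δ μ) subspace D Q (λ _ eq → eq) (λ _ eq → eq)
          (quadraticForm-cong F n δ μ) (quadraticForm-scale F n δ μ) Qr≉0 Q-+

mainTheorem6 : ∀ {c ℓ} p (q : ℕ) (q-even : IsEvenPrimePower q) (F : FiniteField c ℓ q) →
    ∀ (n : ℕ) → 2 ≤ n →
    ∀ (δ : FiniteField.Carrier F) → IsIrreducibleX²+X+ F δ →
    ∀ (μ : FiniteField.Carrier F) → ¬ (FiniteField._≈_ F μ (FiniteField.0# F)) →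
    IsOvoid F n p (_/_ (q ^ n ∸ 1) (q ∸ 1) {{q∸1≢0 q-even}}) (quadric F n δ μ)
mainTheorem6 p q q-even F (suc (suc m)) (s≤s (s≤s z≤n)) δ irreducible μ μ≉0 G =
  ≡.subst (HasCardinality (_∩ᴾ_ F (quadric F (suc (suc m)) δ μ) (Generator.subspace G)))
    (pointCount≡ (primePower>1 (proj₁ q-even)) {{q∸1≢0 q-even}} (suc (suc m)))
    (Quadric.quadric∩G F q-even m irreducible μ G)
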